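{- Let $q=5^{\alpha}$ with $\alpha\ge 1$, and let $D=(P,B)$ and $G=\operatorname{PSL}(2,q)$ be as in the context. Then $D$ is a $\mathrm{GPBIBD}(m)$ with parameters $$v=\frac{q^2-1}{4},\quad b=\frac{q(q^2-1)}{120},\quad k=6,\quad r=\frac{q}{5}=5^{\alpha-1},\quad \lambda_1=1,\quad \lambda_2=\dots=\lambda_m=0,$$ whose underlying association scheme is the Schurian scheme $\mathcal{S}(G,P)$ of the action of $G$ on $P$, and the number of associate classes is $m=\frac{q-3}{2}$.
   Context: Let $\omega$ be a generator of $\mathbb{F}_q^{\times}$ and $i=\omega^{(q-1)/4}$. Let $P=(\mathbb{F}_q^2\setminus\{0\})/\langle i\rangle$ (nonzero column vectors with $\pi,-\pi,i\pi,-i\pi$ identified). $G=\operatorname{PSL}(2,q)=\operatorname{SL}(2,q)/\{\pm I\}$ acts on $P$ by multiplying representatives. Let $T\subseteq P$ be the set of classes of $\binom{1}{0},\binom{0}{1},\binom{1}{1},\binom{1+i}{1},\binom{i}{1},\binom{1}{1-i}$, $B=\{gT:g\in G\}$, and $D=(P,B)$ the incidence structure with points $P$ and blocks $B$. An association scheme with $m$ classes on a finite set $X$ is a partition of $X\times X$ into relations $R_0,\dots,R_m$ with $R_0=\{(x,x)\}$, each $R_j^{ -1}$ again one of the relations, and such that for $(x,z)\in R_k$ the number of $y$ with $(x,y)\in R_i,(y,z)\in R_j$ depends only on $i,j,k$. The Schurian scheme $\mathcal{S}(G,P)$ has as relations the orbits of $G$ on $P\times P$. A $\mathrm{GPBIBD}(m)$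 with parameters $v,b,k,r,\lambda_1,\dots,\lambda_m$ is a block design with $v$ points and $b$ blocks, each block of size $k$, each point on $r$ blocks, together with an association scheme (not necessarily symmetric) with classes $R_0,\dots,R_m$ on the point set such that for each $1\le j\le m$ any pair $(x,y)\in R_j$ lies together in exactly $\lambda_j$ blocks (for a suitable numbering of the non-identity classes). -}

module Defs where

open import Level using (0ℓ)
open import Algebra.Bundles using (CommutativeRing)
open import Data.Nat using (ℕ; zero; suc)
open import Data.Fin using (Fin; toℕ)
import Data.Fin as Fin
import Data.Nat
open import Data.Product using (Σ; ∃; ∃-syntax; _×_; _,_)
open import Data.Unit using (⊤)
open import Relation.Nullary using (¬_)
open import Relation.Binary.Core using (Rel)
open import Relation.Binary.Definitions using (Decidable)
open import Relation.Binary.PropositionalEquality using (_≡_)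

HasSize : {A : Set} → (A → A → Set) → (A → Set) → ℕ → Set
HasSize {A} _≈_ P n =
  Σ (Fin n → A) λ f →
    (∀ j → P (f j)) ×
    (∀ j j' → f j ≈ f j' → j ≡ j') ×
    (∀ x → P x → ∃[ j ] (x ≈ f j))

_⇔_ : Set → Set → Set
infix 0 _⇔_
A ⇔ B = (A → B) × (B → A)

record Field : Set₁ where
  field
    commRing : CommutativeRing 0ℓ 0ℓ
  open CommutativeRing commRing public
  field
    _≟_    : Decidable _≈_
    1≉0    : ¬ (1# ≈ 0#)
    inverse : ∀ x → ¬ (x ≈ 0#) → ∃[ y ] (x * y ≈ 1#)

IsFiniteOfOrder : Field → ℕ → Set
IsFiniteOfOrder F q = HasSize (Field._≈_ F) (λ _ → ⊤) q

-- Association schemes and GPBIBDs on a point set given as a type X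
-- together with an equivalence _≈_ and a predicate IsPt (the points are
-- the ≈-classes of elements satisfying IsPt). A classification
-- cls : X → X → Fin (suc m) encodes the relations R₀,…,R_m:
-- (x , y) ∈ R_j  iff  cls x y ≡ j.

record IsAssociationScheme {X : Set} (_≈_ : X → X → Set) (IsPt : X → Set)
         (m : ℕ) (cls : X → X → Fin (suc m)) : Set where
  field
    respects : ∀ x x' y y' → IsPt x → IsPt y → x ≈ x' → y ≈ y' →
               cls x y ≡ cls x' y'
    diagonal : ∀ x y → IsPt x → IsPt y → ((toℕ (cls x y) ≡ 0) ⇔ (x ≈ y))
    -- each relation is nonempty (so there are exactly m+1 relations)
    nonempty : ∀ j → ∃[ x ] ∃[ y ] (IsPt x × IsPt y × cls x y ≡ j)
    transpose : ∀ j → ∃[ j' ] (∀ x y → IsPt x → IsPt y →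
                  (cls x y ≡ j ⇔ cls y x ≡ j'))
    intersection : ∀ i j k → ∃[ p ] (∀ x z → IsPt x → IsPt z → cls x z ≡ k →
                     HasSize _≈_ (λ y → IsPt y × cls x y ≡ i × cls y z ≡ j) p)

-- Blocks are given as a type Y of labels with an equivalence _≈B_
-- (two labels denote the same block) and incidence InB.
record IsGPBIBD {X Y : Set} (_≈_ : X → X → Set) (IsPt : X → Set)
         (_≈B_ : Y → Y → Set) (InB : Y → X → Set)
         (m : ℕ) (cls : X → X → Fin (suc m))
         (v b k r : ℕ) (λs : ℕ → ℕ) : Set where
  field
    scheme  : IsAssociationScheme _≈_ IsPt m cls
    nPoints : HasSize _≈_ IsPt v
    nBlocks : HasSize _≈B_ (λ _ → ⊤) b
    blockSize : ∀ B → HasSize _≈_ (λ x → IsPt x × InB B x) k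
    replication : ∀ x → IsPt x → HasSize _≈B_ (λ B → InB B x) r
    balance : ∀ x y → IsPt x → IsPt y → 1 Data.Nat.≤ toℕ (cls x y) →
              HasSize _≈B_ (λ B → InB B x × InB B y) (λs (toℕ (cls x y)))

-- The construction of the paper, for a field F, an integer q (its order)
-- and an element ω (a generator of F^×).

module Construction (F : Field) (q : ℕ) (ω : Field.Carrier F) where
  open Field F

  pow : Carrier → ℕ → Carrier
  pow x zero    = 1#
  pow x (suc n) = x * pow x n

  ι : Carrier
  ι = pow ω ((q Data.Nat.∸ 1) Data.Nat./ 4)

  Vec2 : Set
  Vec2 = Carrier × Carrier

  IsPt : Vec2 → Set
  IsPt (x , y) = ¬ ((x ≈ 0#) × (y ≈ 0#))

  -- π ~ π' iff π' = i^n π for some n (i.e. same class in P = (F²∖0)/⟨i⟩)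
  _~_ : Vec2 → Vec2 → Set
  (x , y) ~ (x' , y') = ∃[ n ] ((pow ι (toℕ {4} n) * x ≈ x') × (pow ι (toℕ {4} n) * y ≈ y'))

  -- SL(2,F) (PSL(2,F) acts on P through SL(2,F), since -I ∈ ⟨i⟩)
  record SL : Set where
    field
      a b c d : Carrier
      det : a * d + - (b * c) ≈ 1#

  act : SL → Vec2 → Vec2
  act g (x , y) = (a * x + b * y , c * x + d * y)
    where open SL g

  T : Fin 6 → Vec2
  T Fin.zero = (1# , 0#)
  T (Fin.suc Fin.zero) = (0# , 1#)
  T (Fin.suc (Fin.suc Fin.zero)) = (1# , 1#)
  T (Fin.suc (Fin.suc (Fin.suc Fin.zero))) = (1# + ι , 1#)
  T (Fin.suc (Fin.suc (Fin.suc (Fin.suc Fin.zero)))) = (ι , 1#)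
  T (Fin.suc (Fin.suc (Fin.suc (Fin.suc (Fin.suc Fin.zero))))) = (1# , 1# + - ι)

  InB : SL → Vec2 → Set
  InB g p = ∃[ j ] (p ~ act g (T j))

  _≈B_ : SL → SL → Set
  g ≈B h = ∀ p → IsPt p → (InB g p ⇔ InB h p)

  IsSchurian : (m : ℕ) → (Vec2 → Vec2 → Fin (suc m)) → Set
  IsSchurian m cls = ∀ x y x' y' → IsPt x → IsPt y → IsPt x' → IsPt y' →
    (cls x y ≡ cls x' y' ⇔ ∃[ g ] ((act g x ~ x') × (act g y ~ y')))

if1 : ℕ → ℕ
if1 1 = 1
if1 _ = 0

{-# OPTIONS --safe #-}
module Submission where

open import Defs
open import Level using (0ℓ)
open import Algebra.Bundles using (RawRing)
import Algebra.Properties.CommutativeMonoid.Sum as Sum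
import Algebra.Properties.Monoid.Mult as MonoidMult
import Algebra.Properties.Monoid.Mult.TCOptimised as MonoidMultTC
import Algebra.Properties.Ring as RingProperties
import Algebra.Properties.Semiring.Mult.TCOptimised as SemiringMult
import Algebra.Solver.Ring as RingSolver
open import Algebra.Solver.Ring.AlmostCommutativeRing using (_-Raw-AlmostCommutative⟶_; fromCommutativeRing)
open import Data.Fin using (Fin; zero; suc; toℕ; combine; remQuot; punchIn; punchOut)
import Data.Fin as Fin
import Data.Fin.Permutation as Perm
import Data.Fin.Properties as Fin
open import Data.Maybe using (map)
open import Data.Nat using (ℕ; zero; suc)
import Data.Nat as ℕ
import Data.Nat.Divisibility as ℕ
import Data.Nat.DivMod as ℕ
import Data.Nat.Properties as ℕ
open import Data.Nat.Solver using (module +-*-Solver)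
open import Data.Product using (Σ; ∃; ∃-syntax; _×_; _,_; proj₁; proj₂)
open import Data.Sum using (_⊎_; inj₁; inj₂; [_,_]′)
open import Data.Unit using (⊤; tt)
open import Function using (_∘_; id; _$_)
open import Relation.Binary.Definitions using (Decidable; tri<; tri≈; tri>)
open import Relation.Binary.PropositionalEquality as ≡ using (_≡_)
import Relation.Binary.Reasoning.Setoid as SetoidReasoning
open import Relation.Binary.Structures using (IsEquivalence)
open import Relation.Nullary using (¬_; Dec; yes; no; contradiction)
open import Relation.Nullary.Decidable using (_×-dec_; dec⇒maybe)
import Relation.Nullary.Decidable as Dec

-- Since ι = ±2, the group ⟨ι⟩ is 𝔽₅ˣ, so points are punctured 𝔽₅-lines of F², T consists of all points
-- of 𝔽₅², and the block gT of the points of the lattice g 𝔽₅². Two distinct points x, y lie in such a lattice of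
-- determinant 1 iff det x y ∈ 𝔽₅ˣ, and the lattice is then unique, being spanned by x and a multiple of y.
-- The orbits of G on pairs are classified by det x y modulo 𝔽₅ˣ when it is nonzero, and by the ratio y / x
-- modulo 𝔽₅ˣ otherwise; this gives 2 (q - 1) / 4 relations, one of which (det x y ∈ 𝔽₅ˣ) has λ = 1. The blocks
-- through x correspond to F / 𝔽₅, and b follows by counting flags.

-- The equality ι = ±2 comes from the factorisation x⁴ - 1 = (x² - 1)(x - 2)(x - 3) modulo 5
-- together with ι² ≠ 1. Which sign occurs depends on ω, so every explicit computation with `T`
-- splits into two cases. The invariants are well defined because a change of representatives
-- multiplies determinant and ratio by a power of ι, and complete because two vectors of determinant
-- 1 are the columns of an element of SL(2, q). Classes in Fˣ/⟨ι⟩ are read off from exponents of ω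
-- modulo N = (q - 1)/4. Once the relations are known to be the orbits, transposes and intersection
-- numbers follow by moving one representative pair with a group element; no intersection number is
-- computed. Points and blocks are classes without canonical representatives, so the counts are
-- indirect: decidability of the equivalence yields some number of classes, and a known common class
-- size then determines it. For blocks, decidability itself rests on the uniqueness of the block
-- through two independent points.

module _ {A : Set} {_≈_ : A → A → Set} (≈-equiv : IsEquivalence _≈_) where
  open IsEquivalence ≈-equiv

  size-≤ : ∀ {P m n} → HasSize _≈_ P n → (f : Fin m → A) → (∀ j → P (f j)) →
           (∀ j j' → f j ≈ f j' → j ≡ j') → m ℕ.≤ n
  size-≤ {P} (g , _ , _ , covers) f Pf f-inj = Fin.injective⇒≤ {f = idx} idx-inj
    where
    idx = λ j → proj₁ (covers (f j) (Pf j))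
    idx-inj : ∀ {j j'} → idx j ≡ idx j' → j ≡ j'
    idx-inj {j} {j'} eq = f-inj j j' (trans (proj₂ (covers (f j) (Pf j)))
      (trans (reflexive (≡.cong g eq)) (sym (proj₂ (covers (f j') (Pf j'))))))

  size-unique : ∀ {P m n} → HasSize _≈_ P m → HasSize _≈_ P n → m ≡ n
  size-unique S@(f , Pf , f-inj , _) T@(g , Pg , g-inj , _) =
    ℕ.≤-antisym (size-≤ T f Pf f-inj) (size-≤ S g Pg g-inj)

  size-⇔ : ∀ {P Q n} → (∀ x → P x ⇔ Q x) → HasSize _≈_ P n → HasSize _≈_ Q n
  size-⇔ P⇔Q (f , Pf , f-inj , covers) =
    f , (λ j → proj₁ (P⇔Q _) (Pf j)) , f-inj , λ x Qx → covers x (proj₂ (P⇔Q x) Qx)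

  -- The map may use the proof of membership: a block through a vector, for instance, can only be
  -- built from a proof that the vector is nonzero.
  size-image : ∀ {B : Set} {_≈′_ : B → B → Set} {P : B → Set} {Q : A → Set} {n} (φ : ∀ x → P x → A) →
    (∀ x Px → Q (φ x Px)) →
    (∀ x y Px Py → x ≈′ y → φ x Px ≈ φ y Py) →
    (∀ x y Px Py → φ x Px ≈ φ y Py → x ≈′ y) →
    (∀ y → Q y → ∃[ x ] Σ (P x) λ Px → y ≈ φ x Px) →
    HasSize _≈′_ P n → HasSize _≈_ Q n
  size-image φ P⇒Q φ-cong φ-inj φ-surj (f , Pf , f-inj , covers) =
    (λ j → φ (f j) (Pf j)) , (λ j → P⇒Q _ _) ,
    (λ j j' eq → f-inj j j' (φ-inj _ _ (Pf j) (Pf j') eq)) ,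
    λ y Qy → let (x , Px , y≈φx) = φ-surj y Qy ; (j , x≈fj) = covers x Px
             in j , trans y≈φx (φ-cong _ _ Px (Pf j) x≈fj)

  private
    -- Greedy thinning from the end of the list: an entry is kept iff it satisfies `Q` and no entry
    -- kept so far is equivalent to it.
    representatives : Decidable _≈_ → ∀ {Q : A → Set} → (∀ x → Dec (Q x)) → ∀ n (f : Fin n → A) →
      ∃[ m ] Σ (Fin m → Fin n) λ h →
        (∀ i → Q (f (h i))) × (∀ i i' → f (h i) ≈ f (h i') → i ≡ i') ×
        (∀ j → Q (f j) → ∃[ i ] (f j ≈ f (h i)))
    representatives _≈?_ Q? zero f = 0 , (λ ()) , (λ ()) , (λ ()) , λ ()
    representatives _≈?_ {Q} Q? (suc n) f
      with m , h , Qh , h-inj , covers ← representatives _≈?_ Q? n (f ∘ suc)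
      with Q? (f zero) | Fin.any? (λ i → f zero ≈? f (suc (h i)))
    ... | no ¬q | _ = m , suc ∘ h , Qh , h-inj , λ { zero q → contradiction q ¬q ; (suc j) → covers j }
    ... | yes _ | yes (i , eq) = m , suc ∘ h , Qh , h-inj , λ { zero _ → i , eq ; (suc j) → covers j }
    ... | yes q | no new = suc m , h′ , Qh′ , h′-inj , covers′
      where
      h′ : Fin (suc m) → Fin (suc n)
      h′ zero = zero
      h′ (suc i) = suc (h i)
      Qh′ : ∀ i → Q (f (h′ i))
      Qh′ zero = q
      Qh′ (suc i) = Qh i
      h′-inj : ∀ i i' → f (h′ i) ≈ f (h′ i') → i ≡ i'
      h′-inj zero zero _ = ≡.refl
      h′-inj zero (suc i') eq = contradiction (i' , eq) new
      h′-inj (suc i) zero eq = contradiction (i , sym eq) new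
      h′-inj (suc i) (suc i') eq = ≡.cong suc (h-inj i i' eq)
      covers′ : ∀ j → Q (f j) → ∃[ i ] (f j ≈ f (h′ i))
      covers′ zero _ = zero , refl
      covers′ (suc j) qj = let (i , eq) = covers j qj in suc i , eq

  -- Serves two purposes: with trivial `Q` it counts the classes of a coarser equivalence, and with
  -- both equivalences equal it shows that a decidable subset is finite.
  subset-size : Decidable _≈_ → ∀ {_≈′_ : A → A → Set} {P Q : A → Set} {n} → (∀ x → Dec (Q x)) →
    (∀ {x y} → x ≈′ y → x ≈ y) → (∀ {x y} → P x → P y → x ≈ y → Q x → Q y) →
    HasSize _≈′_ P n → ∃[ m ] HasSize _≈_ (λ x → P x × Q x) m
  subset-size _≈?_ Q? fine Q-resp (f , Pf , _ , covers)
    with m , h , Qh , h-inj , h-covers ← representatives _≈?_ Q? _ f =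
    m , f ∘ h , (λ i → Pf (h i) , Qh i) , h-inj , λ x (Px , Qx) →
      let (j , x≈fj) = covers x Px
          (i , fj≈)  = h-covers j (Q-resp Px (Pf j) (fine x≈fj) Qx)
      in i , trans (fine x≈fj) fj≈

  fibre-size : ∀ {_≈′_ : A → A → Set} {P : A → Set} {n k} → (∀ {x y} → x ≈′ y → x ≈ y) →
    HasSize _≈_ P n → (∀ x → P x → HasSize _≈′_ (λ y → P y × x ≈ y) k) →
    HasSize _≈′_ P (n ℕ.* k)
  fibre-size {_≈′_} {P} {n} {k} fine (f , Pf , f-inj , covers) fibre =
    (λ t → F (remQuot k t)) , (λ t → PF (remQuot k t)) , inj , cov
    where
    F : Fin n × Fin k → A
    F (i , j) = proj₁ (fibre (f i) (Pf i)) j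
    PF : ∀ t → P (F t)
    PF (i , j) = proj₁ (proj₁ (proj₂ (fibre (f i) (Pf i))) j)
    near : ∀ i j → f i ≈ F (i , j)
    near i j = proj₂ (proj₁ (proj₂ (fibre (f i) (Pf i))) j)
    F-inj : ∀ s t → F s ≈′ F t → s ≡ t
    F-inj (i , j) (i' , j') eq
      -- The enumeration of a fibre depends on its class, so the classes must be identified before
      -- positions inside them can be compared.
      with ≡.refl ← f-inj i i' (trans (near i j) (trans (fine eq) (sym (near i' j')))) =
      ≡.cong (i ,_) (proj₁ (proj₂ (proj₂ (fibre (f i) (Pf i)))) j j' eq)
    inj : ∀ s t → F (remQuot k s) ≈′ F (remQuot k t) → s ≡ t
    inj s t eq = ≡.trans (≡.sym (Fin.combine-remQuot {n} k s))
      (≡.trans (≡.cong (λ (i , j) → combine i j) (F-inj _ _ eq)) (Fin.combine-remQuot {n} k t))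
    cov : ∀ x → P x → ∃[ t ] (x ≈′ F (remQuot k t))
    cov x Px =
      let (i , x≈fi) = covers x Px
          (j , x≈)   = proj₂ (proj₂ (proj₂ (fibre (f i) (Pf i)))) x (Px , sym x≈fi)
      in combine i j , ≡.subst (λ s → x ≈′ F s) (≡.sym (Fin.remQuot-combine i j)) x≈

  size-remove : ∀ {P : A → Set} {n o} → P o → HasSize _≈_ P (suc n) →
    HasSize _≈_ (λ x → P x × ¬ (x ≈ o)) n
  size-remove {P} {n} {o} Po (f , Pf , f-inj , covers) =
    f ∘ punchIn k , (λ j → Pf _ , λ eq → Fin.punchInᵢ≢i k j (f-inj _ _ (trans eq o≈fk))) ,
    (λ j j' eq → Fin.punchIn-injective k j j' (f-inj _ _ eq)) ,
    λ x (Px , x≉o) →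
      let (j , x≈fj) = covers x Px
          k≢j = λ k≡j → x≉o (trans x≈fj (trans (reflexive (≡.cong f (≡.sym k≡j))) (sym o≈fk)))
      in punchOut k≢j , trans x≈fj (reflexive (≡.cong f (≡.sym (Fin.punchIn-punchOut k≢j))))
    where
    k = proj₁ (covers o Po)
    o≈fk = proj₂ (covers o Po)

-- Thinning gives an unknown number n of classes; multiplying by the class size re-enumerates `P`,
-- and uniqueness of size yields n k = N. The values of v, k, r and b are all found this way.
quotient-size : ∀ {A : Set} {_≈_ _≈′_ : A → A → Set} {P : A → Set} {N k} →
  IsEquivalence _≈_ → IsEquivalence _≈′_ → Decidable _≈_ →
  (∀ {x y} → x ≈′ y → x ≈ y) → HasSize _≈′_ P N →
  (∀ x → P x → HasSize _≈′_ (λ y → P y × x ≈ y) k) →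
  ∃[ n ] (HasSize _≈_ P n × n ℕ.* k ≡ N)
quotient-size {_≈_ = _≈_} {P = P} ≈-equiv ≈′-equiv _≈?_ fine S fibre =
  n , S/≈ , size-unique ≈′-equiv (fibre-size ≈-equiv fine S/≈ fibre) S
  where
  S/≈-⊤ = subset-size ≈-equiv _≈?_ {Q = λ _ → ⊤} (λ _ → yes tt) fine (λ _ _ _ _ → tt) S
  n = proj₁ S/≈-⊤
  S/≈ : HasSize _≈_ P n
  S/≈ = size-⇔ ≈-equiv (λ _ → proj₁ , (_, tt)) (proj₂ S/≈-⊤)

size-× : ∀ {A B : Set} {_≈_ : A → A → Set} {_≈′_ : B → B → Set} {P Q m n} →
  HasSize _≈_ P m → HasSize _≈′_ Q n →
  HasSize (λ (a , b) (a' , b') → (a ≈ a') × (b ≈′ b')) (λ (a , b) → P a × Q b) (m ℕ.* n)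
size-× {_≈_ = _≈_} {_≈′_} {m = m} {n} (f , Pf , f-inj , f-covers) (g , Qg , g-inj , g-covers) =
  (λ t → fg (remQuot n t)) , (λ t → Pf _ , Qg _) ,
  (λ s t (e , e') → ≡.trans (≡.sym (Fin.combine-remQuot {m} n s))
    (≡.trans (≡.cong₂ combine (f-inj _ _ e) (g-inj _ _ e')) (Fin.combine-remQuot {m} n t))) ,
  λ (a , b) (Pa , Qb) →
    let (i , a≈) = f-covers a Pa ; (j , b≈) = g-covers b Qb
    in combine i j , ≡.subst (λ s → (a ≈ proj₁ (fg s)) × (b ≈′ proj₂ (fg s))) (≡.sym (Fin.remQuot-combine i j)) (a≈ , b≈)
  where
  fg = λ (t : Fin m × Fin n) → f (proj₁ t) , g (proj₂ t)

-- Integer multiples of 1, cancellation and the characteristic.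

module FieldProperties (F : Field) where
  open Field F hiding (zero)
  open RingProperties ring
  open SemiringMult semiring using (×1-homo-*) renaming (_×_ to _·_; ×-homo-+ to ·-homo-+)
  open SetoidReasoning setoid

  ⟦_⟧ : ℕ → Carrier
  ⟦ n ⟧ = n · 1#

  ⟦⟧-+ : ∀ m n → ⟦ m ℕ.+ n ⟧ ≈ ⟦ m ⟧ + ⟦ n ⟧
  ⟦⟧-+ = ·-homo-+ 1#

  ⟦⟧-* : ∀ m n → ⟦ m ℕ.* n ⟧ ≈ ⟦ m ⟧ * ⟦ n ⟧
  ⟦⟧-* = ×1-homo-*

  ⟦⟧-cong : ∀ {m n} → m ≡ n → ⟦ m ⟧ ≈ ⟦ n ⟧
  ⟦⟧-cong eq = reflexive (≡.cong ⟦_⟧ eq)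

  cancelˡ : ∀ {a} x y → ¬ (a ≈ 0#) → a * x ≈ a * y → x ≈ y
  cancelˡ {a} x y a≉0 eq = let (a⁻¹ , a*a⁻¹≈1) = inverse a a≉0 in begin
    x              ≈⟨ *-identityˡ x ⟨
    1# * x         ≈⟨ *-congʳ (trans (*-comm a⁻¹ a) a*a⁻¹≈1) ⟨
    (a⁻¹ * a) * x  ≈⟨ *-assoc a⁻¹ a x ⟩
    a⁻¹ * (a * x)  ≈⟨ *-congˡ eq ⟩
    a⁻¹ * (a * y)  ≈⟨ *-assoc a⁻¹ a y ⟨
    (a⁻¹ * a) * y  ≈⟨ *-congʳ (trans (*-comm a⁻¹ a) a*a⁻¹≈1) ⟩
    1# * y         ≈⟨ *-identityˡ y ⟩
    y              ∎

  *-≉0 : ∀ {a b} → ¬ (a ≈ 0#) → ¬ (b ≈ 0#) → ¬ (a * b ≈ 0#)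
  *-≉0 {a} {b} a≉0 b≉0 ab≈0 = b≉0 (cancelˡ b 0# a≉0 (trans ab≈0 (sym (zeroʳ a))))

  zero-divisor : ∀ {a b} → a * b ≈ 0# → (a ≈ 0#) ⊎ (b ≈ 0#)
  zero-divisor {a} ab≈0 with a ≟ 0#
  ... | yes a≈0 = inj₁ a≈0
  ... | no a≉0 = inj₂ (cancelˡ _ 0# a≉0 (trans ab≈0 (sym (zeroʳ a))))

  ≉0-factorˡ : ∀ {a b} → a * b ≈ 1# → ¬ (a ≈ 0#)
  ≉0-factorˡ {b = b} ab≈1 a≈0 = 1≉0 (trans (sym ab≈1) (trans (*-congʳ a≈0) (zeroˡ b)))

  -- Translation by 1 permutes F, so the sum of all elements equals itself plus q · 1.
  order·1≈0 : ∀ {q} → IsFiniteOfOrder F q → ⟦ q ⟧ ≈ 0#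
  order·1≈0 {q} (f , _ , f-inj , covers) = +-cancelˡ (sum f) ⟦ q ⟧ 0# $ begin
    sum f + ⟦ q ⟧                ≈⟨ +-congˡ (MonoidMultTC.×ᵤ≈× +-monoid q 1#) ⟨
    sum f + q ×ᵤ 1#              ≈⟨ +-congˡ (sum-replicate q) ⟨
    sum f + sum {q} (λ _ → 1#)   ≈⟨ ∑-distrib-+ f (λ _ → 1#) ⟨
    sum (λ j → f j + 1#)         ≈⟨ sum-cong-≋ (λ j → proj₂ (covers (f j + 1#) tt)) ⟩
    sum (λ j → f (next j))       ≈⟨ sum-permute f shift ⟨
    sum f                        ≈⟨ +-identityʳ (sum f) ⟨
    sum f + 0#                   ∎
    where
    open Sum +-commutativeMonoid using (sum; sum-replicate; ∑-distrib-+; sum-cong-≋; sum-permute)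
    open MonoidMult +-monoid using () renaming (_×_ to _×ᵤ_)
    next prev : Fin q → Fin q
    next j = proj₁ (covers (f j + 1#) tt)
    prev j = proj₁ (covers (f j + - 1#) tt)
    next-prev : ∀ j → next (prev j) ≡ j
    next-prev j = f-inj _ _ $ begin
      f (next (prev j))    ≈⟨ proj₂ (covers (f (prev j) + 1#) tt) ⟨
      f (prev j) + 1#      ≈⟨ +-congʳ (proj₂ (covers (f j + - 1#) tt)) ⟨
      f j + - 1# + 1#      ≈⟨ +-assoc _ _ _ ⟩
      f j + (- 1# + 1#)    ≈⟨ +-congˡ (-‿inverseˡ 1#) ⟩
      f j + 0#             ≈⟨ +-identityʳ _ ⟩
      f j                  ∎
    prev-next : ∀ j → prev (next j) ≡ j
    prev-next j = f-inj _ _ $ begin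
      f (prev (next j))    ≈⟨ proj₂ (covers (f (next j) + - 1#) tt) ⟨
      f (next j) + - 1#    ≈⟨ +-congʳ (proj₂ (covers (f j + 1#) tt)) ⟨
      f j + 1# + - 1#      ≈⟨ +-assoc _ _ _ ⟩
      f j + (1# + - 1#)    ≈⟨ +-congˡ (-‿inverseʳ 1#) ⟩
      f j + 0#             ≈⟨ +-identityʳ _ ⟩
      f j                  ∎
    shift : Perm.Permutation q q
    shift = Perm.permutation next prev next-prev prev-next

  -- A field has no zero divisors, so one of the factors of p · p^(α-1) vanishes; the descent stops
  -- at 1 ≠ 0.
  prime-power-characteristic : ∀ p α → ⟦ p ℕ.^ α ⟧ ≈ 0# → ⟦ p ⟧ ≈ 0#
  prime-power-characteristic p zero eq = contradiction eq 1≉0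
  prime-power-characteristic p (suc α) eq =
    [ id , prime-power-characteristic p α ]′ (zero-divisor (trans (sym (⟦⟧-* p (p ℕ.^ α))) eq))

-- Arithmetic in characteristic 5.

module CharacteristicFive (F : Field) (5≈0 : Field._≈_ F (FieldProperties.⟦_⟧ F 5) (Field.0# F)) where
  open Field F hiding (zero)
  open RingProperties ring
  open FieldProperties F
  open SetoidReasoning setoid

  ⟦⟧-%5 : ∀ n → ⟦ n ℕ.% 5 ⟧ ≈ ⟦ n ⟧
  ⟦⟧-%5 n = begin
    ⟦ n ℕ.% 5 ⟧                        ≈⟨ +-identityʳ _ ⟨
    ⟦ n ℕ.% 5 ⟧ + 0#                   ≈⟨ +-congˡ (zeroʳ _) ⟨
    ⟦ n ℕ.% 5 ⟧ + ⟦ n ℕ./ 5 ⟧ * 0#     ≈⟨ +-congˡ (*-congˡ 5≈0) ⟨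
    ⟦ n ℕ.% 5 ⟧ + ⟦ n ℕ./ 5 ⟧ * ⟦ 5 ⟧  ≈⟨ +-congˡ (⟦⟧-* (n ℕ./ 5) 5) ⟨
    ⟦ n ℕ.% 5 ⟧ + ⟦ n ℕ./ 5 ℕ.* 5 ⟧    ≈⟨ ⟦⟧-+ (n ℕ.% 5) (n ℕ./ 5 ℕ.* 5) ⟨
    ⟦ n ℕ.% 5 ℕ.+ n ℕ./ 5 ℕ.* 5 ⟧      ≈⟨ ⟦⟧-cong (ℕ.m≡m%n+[m/n]*n n 5) ⟨
    ⟦ n ⟧                              ∎

  -- Since 4 = -1 modulo 5, natural numbers suffice as coefficients even where negation is required.
  ⟦4*⟧ : ∀ n → ⟦ 4 ℕ.* n ⟧ ≈ - ⟦ n ⟧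
  ⟦4*⟧ n = +-cancelˡ ⟦ n ⟧ _ _ $ begin
    ⟦ n ⟧ + ⟦ 4 ℕ.* n ⟧  ≈⟨ ⟦⟧-+ n (4 ℕ.* n) ⟨
    ⟦ 5 ℕ.* n ⟧          ≈⟨ ⟦⟧-* 5 n ⟩
    ⟦ 5 ⟧ * ⟦ n ⟧        ≈⟨ *-congʳ 5≈0 ⟩
    0# * ⟦ n ⟧           ≈⟨ zeroˡ _ ⟩
    0#                   ≈⟨ -‿inverseʳ ⟦ n ⟧ ⟨
    ⟦ n ⟧ + - ⟦ n ⟧      ∎

  private
    -- Reducing coefficients modulo 5 lets the solver use 5 = 0.
    ℤ/5 : RawRing 0ℓ 0ℓ
    ℤ/5 = record
      { Carrier = ℕ ; _≈_ = _≡_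
      ; _+_ = λ m n → (m ℕ.+ n) ℕ.% 5 ; _*_ = λ m n → (m ℕ.* n) ℕ.% 5
      ; -_ = λ n → (4 ℕ.* n) ℕ.% 5 ; 0# = 0 ; 1# = 1 }

    ℤ/5⟶F : ℤ/5 -Raw-AlmostCommutative⟶ fromCommutativeRing commRing
    ℤ/5⟶F = record
      { ⟦_⟧ = ⟦_⟧
      ; +-homo = λ m n → trans (⟦⟧-%5 (m ℕ.+ n)) (⟦⟧-+ m n)
      ; *-homo = λ m n → trans (⟦⟧-%5 (m ℕ.* n)) (⟦⟧-* m n)
      ; -‿homo = λ n → trans (⟦⟧-%5 (4 ℕ.* n)) (⟦4*⟧ n)
      ; 0-homo = refl ; 1-homo = refl }

  module Solver = RingSolver ℤ/5 (fromCommutativeRing commRing) ℤ/5⟶F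
    (λ m n → map ⟦⟧-cong (dec⇒maybe (m ℕ.≟ n)))
  open Solver using (solve; _:=_; _:+_; _:*_; :-_; con)

  -- Modulo 5, i⁴ - 1 = (i² - 1)(i + 3)(i + 2), and the first factor is excluded.
  primitive-fourth-root : ∀ {i} → i * (i * (i * (i * 1#))) ≈ 1# → ¬ (i * (i * 1#) ≈ 1#) →
    (i ≈ ⟦ 2 ⟧) ⊎ (i ≈ ⟦ 3 ⟧)
  primitive-fourth-root {i} i⁴≈1 i²≉1 with zero-divisor
    (trans (solve 1 (λ i → (i :* (i :* con 1) :+ :- con 1) :* ((i :+ con 3) :* (i :+ con 2)) :=
                           i :* (i :* (i :* (i :* con 1))) :+ :- con 1) refl i)
           (trans (+-congʳ i⁴≈1) (-‿inverseʳ 1#)))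
  ... | inj₁ i²-1≈0 = contradiction (x∙y⁻¹≈ε⇒x≈y _ _ i²-1≈0) i²≉1
  ... | inj₂ eq with zero-divisor eq
  ...   | inj₁ i+3≈0 = inj₁ (trans (solve 1 (λ i → i := (i :+ con 3) :+ con 2) refl i)
                                   (trans (+-congʳ i+3≈0) (+-identityˡ _)))
  ...   | inj₂ i+2≈0 = inj₂ (trans (solve 1 (λ i → i := (i :+ con 2) :+ con 3) refl i)
                                   (trans (+-congʳ i+2≈0) (+-identityˡ _)))

-- Powers with natural exponents.

module Powers (F : Field) (q : ℕ) (ω : Field.Carrier F) where
  open Field F hiding (zero)
  open FieldProperties F
  open Construction F q ω using (pow)
  open SetoidReasoning setoid

  pow-cong : ∀ {x y} n → x ≈ y → pow x n ≈ pow y n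
  pow-cong zero eq = refl
  pow-cong (suc n) eq = *-cong eq (pow-cong n eq)

  pow-+ : ∀ x m n → pow x (m ℕ.+ n) ≈ pow x m * pow x n
  pow-+ x zero n = sym (*-identityˡ _)
  pow-+ x (suc m) n = trans (*-congˡ (pow-+ x m n)) (sym (*-assoc x _ _))

  pow-* : ∀ x m n → pow (pow x m) n ≈ pow x (n ℕ.* m)
  pow-* x m zero = refl
  pow-* x m (suc n) = trans (*-congˡ (pow-* x m n)) (sym (pow-+ x m (n ℕ.* m)))

  pow-1 : ∀ n → pow 1# n ≈ 1#
  pow-1 zero = refl
  pow-1 (suc n) = trans (*-identityˡ _) (pow-1 n)

  pow-≉0 : ∀ {x} n → ¬ (x ≈ 0#) → ¬ (pow x n ≈ 0#)
  pow-≉0 zero x≉0 = 1≉0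
  pow-≉0 (suc n) x≉0 = *-≉0 x≉0 (pow-≉0 n x≉0)

  pow-≡ : ∀ x {m n} → m ≡ n → pow x m ≈ pow x n
  pow-≡ x eq = reflexive (≡.cong (pow x) eq)

  pow-% : ∀ {x} d .{{_ : ℕ.NonZero d}} n → pow x d ≈ 1# → pow x (n ℕ.% d) ≈ pow x n
  pow-% {x} d n x^d≈1 = begin
    pow x (n ℕ.% d)                                ≈⟨ *-identityʳ _ ⟨
    pow x (n ℕ.% d) * 1#                           ≈⟨ *-congˡ (trans (pow-cong (n ℕ./ d) x^d≈1) (pow-1 (n ℕ./ d))) ⟨
    pow x (n ℕ.% d) * pow (pow x d) (n ℕ./ d)      ≈⟨ *-congˡ (pow-* x d (n ℕ./ d)) ⟩
    pow x (n ℕ.% d) * pow x (n ℕ./ d ℕ.* d)        ≈⟨ pow-+ x (n ℕ.% d) _ ⟨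
    pow x (n ℕ.% d ℕ.+ n ℕ./ d ℕ.* d)              ≈⟨ pow-≡ x (ℕ.m≡m%n+[m/n]*n n d) ⟨
    pow x n                                        ∎

  pow-∸ : ∀ {x a b} → ¬ (x ≈ 0#) → a ℕ.≤ b → pow x a ≈ pow x b → pow x (b ℕ.∸ a) ≈ 1#
  pow-∸ {x} {a} {b} x≉0 a≤b eq = sym $ cancelˡ 1# (pow x (b ℕ.∸ a)) (pow-≉0 a x≉0) $ begin
    pow x a * 1#                ≈⟨ *-identityʳ _ ⟩
    pow x a                     ≈⟨ eq ⟩
    pow x b                     ≈⟨ pow-≡ x (ℕ.m+[n∸m]≡n a≤b) ⟨
    pow x (a ℕ.+ (b ℕ.∸ a))     ≈⟨ pow-+ x a _ ⟩
    pow x a * pow x (b ℕ.∸ a)   ∎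

-- The cyclic group generated by ω and its subgroup ⟨ι⟩ of order 4.

module Geometry (F : Field) (5≈0 : Field._≈_ F (FieldProperties.⟦_⟧ F 5) (Field.0# F))
  (q N : ℕ) {{N≢0 : ℕ.NonZero N}} (q≡1+4N : q ≡ suc (4 ℕ.* N)) (finite : IsFiniteOfOrder F q)
  (ω : Field.Carrier F)
  (generates : ∀ x → ¬ Field._≈_ F x (Field.0# F) → ∃[ n ] Field._≈_ F (Construction.pow F q ω ω n) x) where

  open Field F hiding (zero)
  open RingProperties ring using (+-cancelˡ)
  open FieldProperties F
  open CharacteristicFive F 5≈0
  open Solver using (solve; _:=_; _:+_; _:*_; :-_; con)
  open Powers F q ω
  open Construction F q ω
  open SetoidReasoning setoid

  Q : ℕ
  Q = 4 ℕ.* N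

  instance
    Q≢0 : ℕ.NonZero Q
    Q≢0 = ℕ.m*n≢0 4 N

  units-size : HasSize _≈_ (λ x → ¬ (x ≈ 0#)) Q
  units-size = size-⇔ isEquivalence (λ x → proj₂ , (tt ,_))
    (size-remove isEquivalence {o = 0#} tt (≡.subst (HasSize _≈_ (λ _ → ⊤)) q≡1+4N finite))

  ω≉0 : ¬ (ω ≈ 0#)
  ω≉0 ω≈0 with generates ⟦ 2 ⟧ (≉0-factorˡ {b = ⟦ 3 ⟧} (solve 0 (con 2 :* con 3 := con 1) refl))
  ... | zero , 1≈2 = 1≉0 (trans (solve 1 (λ x → con 1 := con 2 :+ :- con 1) refl 0#)
                               (trans (+-congʳ (sym 1≈2)) (-‿inverseʳ 1#)))
  ... | suc n , ω*≈2 = contradiction (trans (sym ω*≈2) (trans (*-congʳ ω≈0) (zeroˡ _)))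
                         (≉0-factorˡ {b = ⟦ 3 ⟧} (solve 0 (con 2 :* con 3 := con 1) refl))

  -- If ω^d = 1, a unit is determined by its exponent modulo d, which injects the Q units into d
  -- residues.
  period-≥Q : ∀ d .{{_ : ℕ.NonZero d}} → pow ω d ≈ 1# → Q ℕ.≤ d
  period-≥Q d ω^d≈1 = Fin.injective⇒≤ {f = λ j → exponent j ℕ.mod d} λ {j} {j'} eq →
    proj₁ (proj₂ (proj₂ units-size)) j j' $ begin
      unit j                        ≈⟨ proj₂ (generates (unit j) (unit≉0 j)) ⟨
      pow ω (exponent j)            ≈⟨ pow-% d (exponent j) ω^d≈1 ⟨
      pow ω (exponent j ℕ.% d)      ≈⟨ pow-≡ ω (mod⇒% (exponent j) (exponent j') eq) ⟩
      pow ω (exponent j' ℕ.% d)     ≈⟨ pow-% d (exponent j') ω^d≈1 ⟩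
      pow ω (exponent j')           ≈⟨ proj₂ (generates (unit j') (unit≉0 j')) ⟩
      unit j'                       ∎
    where
    unit = proj₁ units-size
    unit≉0 = proj₁ (proj₂ units-size)
    exponent = λ j → proj₁ (generates (unit j) (unit≉0 j))
    mod⇒% : ∀ m n → m ℕ.mod d ≡ n ℕ.mod d → m ℕ.% d ≡ n ℕ.% d
    mod⇒% m n eq = ≡.trans (≡.sym (Fin.toℕ-fromℕ< (ℕ.m%n<n m d)))
      (≡.trans (≡.cong toℕ eq) (Fin.toℕ-fromℕ< (ℕ.m%n<n n d)))

  -- Takes the place of Lagrange's theorem: two of the Q + 1 powers ω⁰, ..., ω^Q agree, which gives
  -- a period d ≤ Q, and no period is smaller than Q.
  ω^Q≈1 : pow ω Q ≈ 1#
  ω^Q≈1 with Fin.pigeonhole (ℕ.n<1+n Q) (λ j → proj₁ (covers (pow ω (toℕ j)) (pow-≉0 (toℕ j) ω≉0)))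
    where covers = proj₂ (proj₂ (proj₂ units-size))
  ... | i , j , i<j , eq = trans (pow-≡ ω (ℕ.≤-antisym (period-≥Q d ω^d≈1) d≤Q)) ω^d≈1
    where
    covers = proj₂ (proj₂ (proj₂ units-size))
    d = toℕ j ℕ.∸ toℕ i
    instance
      d≢0 : ℕ.NonZero d
      d≢0 = ℕ.>-nonZero (ℕ.m<n⇒0<n∸m i<j)
    d≤Q : d ℕ.≤ Q
    d≤Q = ℕ.≤-trans (ℕ.m∸n≤m (toℕ j) (toℕ i)) (ℕ.s≤s⁻¹ (Fin.toℕ<n j))
    ω^d≈1 : pow ω d ≈ 1#
    ω^d≈1 = pow-∸ ω≉0 (ℕ.<⇒≤ i<j) (begin
      pow ω (toℕ i)  ≈⟨ proj₂ (covers (pow ω (toℕ i)) (pow-≉0 (toℕ i) ω≉0)) ⟩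
      _              ≡⟨ ≡.cong (proj₁ units-size) eq ⟩
      _              ≈⟨ proj₂ (covers (pow ω (toℕ j)) (pow-≉0 (toℕ j) ω≉0)) ⟨
      pow ω (toℕ j)  ∎)

  ω-pow-injective : ∀ {a b} → a ℕ.< Q → b ℕ.< Q → pow ω a ≈ pow ω b → a ≡ b
  ω-pow-injective {a} {b} a<Q b<Q eq with ℕ.<-cmp a b
  ... | tri≈ _ a≡b _ = a≡b
  ... | tri< a<b _ _ = contradiction (ℕ.<-≤-trans b<Q (ℕ.≤-trans
      (period-≥Q (b ℕ.∸ a) (pow-∸ ω≉0 (ℕ.<⇒≤ a<b) eq)) (ℕ.m∸n≤m b a))) (ℕ.<-irrefl ≡.refl)
    where instance _ = ℕ.>-nonZero (ℕ.m<n⇒0<n∸m a<b)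
  ... | tri> _ _ b<a = contradiction (ℕ.<-≤-trans a<Q (ℕ.≤-trans
      (period-≥Q (a ℕ.∸ b) (pow-∸ ω≉0 (ℕ.<⇒≤ b<a) (sym eq))) (ℕ.m∸n≤m a b))) (ℕ.<-irrefl ≡.refl)
    where instance _ = ℕ.>-nonZero (ℕ.m<n⇒0<n∸m b<a)

  -- An exponent of ω is determined modulo Q, hence modulo its divisor N. This makes `log`
  -- independent of the exponent that `generates` happens to return.
  ω-pow-≈⇒%N : ∀ a b → pow ω a ≈ pow ω b → a ℕ.% N ≡ b ℕ.% N
  ω-pow-≈⇒%N a b eq = ≡.trans (≡.sym (ℕ.m∣n⇒o%n%m≡o%m N Q a (ℕ.n∣m*n 4)))
    (≡.trans (≡.cong (ℕ._% N) a%Q≡b%Q) (ℕ.m∣n⇒o%n%m≡o%m N Q b (ℕ.n∣m*n 4)))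
    where
    a%Q≡b%Q = ω-pow-injective (ℕ.m%n<n a Q) (ℕ.m%n<n b Q)
      (trans (pow-% Q a ω^Q≈1) (trans eq (sym (pow-% Q b ω^Q≈1))))

  ι-pow : ∀ k → pow ι k ≈ pow ω (k ℕ.* N)
  ι-pow k = trans (pow-cong k (pow-≡ ω [q∸1]/4≡N)) (pow-* ω N k)
    where
    [q∸1]/4≡N : (q ℕ.∸ 1) ℕ./ 4 ≡ N
    [q∸1]/4≡N = ≡.trans (≡.cong (λ n → (n ℕ.∸ 1) ℕ./ 4) q≡1+4N)
      (≡.trans (ℕ./-congˡ {o = 4} (ℕ.*-comm 4 N)) (ℕ.m*n/n≡m N 4))

  ι-pow-injective : ∀ (k k' : Fin 4) → pow ι (toℕ k) ≈ pow ι (toℕ k') → k ≡ k'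
  ι-pow-injective k k' eq = Fin.toℕ-injective $ ℕ.*-cancelʳ-≡ (toℕ k) (toℕ k') N $
    ω-pow-injective (ℕ.*-monoˡ-< N (Fin.toℕ<n k)) (ℕ.*-monoˡ-< N (Fin.toℕ<n k'))
      (trans (sym (ι-pow (toℕ k))) (trans eq (ι-pow (toℕ k'))))

  ι⁴≈1 : pow ι 4 ≈ 1#
  ι⁴≈1 = trans (ι-pow 4) ω^Q≈1

  ι≉0 : ¬ (ι ≈ 0#)
  ι≉0 = pow-≉0 ((q ℕ.∸ 1) ℕ./ 4) ω≉0

  -- As ι⁴ = 1, the exponent 3k stands for -k; all inverses of powers of ι below are written in this
  -- form.
  ι-pow-3* : ∀ k → pow ι (3 ℕ.* k) * pow ι k ≈ 1#
  ι-pow-3* k = begin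
    pow ι (3 ℕ.* k) * pow ι k    ≈⟨ pow-+ ι (3 ℕ.* k) k ⟨
    pow ι (3 ℕ.* k ℕ.+ k)        ≈⟨ pow-≡ ι (≡.trans (ℕ.+-comm (3 ℕ.* k) k) (ℕ.*-comm 4 k)) ⟩
    pow ι (k ℕ.* 4)              ≈⟨ pow-* ι 4 k ⟨
    pow (pow ι 4) k              ≈⟨ trans (pow-cong k ι⁴≈1) (pow-1 k) ⟩
    1#                           ∎

  -- Both cases really occur: replacing ω by its inverse exchanges them.
  ι≈2⊎3 : (ι ≈ ⟦ 2 ⟧) ⊎ (ι ≈ ⟦ 3 ⟧)
  ι≈2⊎3 = primitive-fourth-root ι⁴≈1 λ ι²≈1 →
    contradiction (ι-pow-injective (suc (suc zero)) zero ι²≈1) λ ()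

  -- The prime field 𝔽₅, as the image of ℕ in F.

  K : Carrier → Set
  K c = ∃[ n ] (c ≈ ⟦ n ⟧)

  K-resp : ∀ {c d} → c ≈ d → K c → K d
  K-resp c≈d (n , c≈n) = n , trans (sym c≈d) c≈n

  K-+ : ∀ {c d} → K c → K d → K (c + d)
  K-+ (m , c≈m) (n , d≈n) = m ℕ.+ n , trans (+-cong c≈m d≈n) (sym (⟦⟧-+ m n))

  K-* : ∀ {c d} → K c → K d → K (c * d)
  K-* (m , c≈m) (n , d≈n) = m ℕ.* n , trans (*-cong c≈m d≈n) (sym (⟦⟧-* m n))

  K-neg : ∀ {c} → K c → K (- c)
  K-neg (n , c≈n) = 4 ℕ.* n , trans (-‿cong c≈n) (sym (⟦4*⟧ n))

  pow-⟦⟧ : ∀ {c} a k → c ≈ ⟦ a ⟧ → pow c k ≈ ⟦ a ℕ.^ k ⟧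
  pow-⟦⟧ a zero _ = refl
  pow-⟦⟧ a (suc k) c≈a = trans (*-cong c≈a (pow-⟦⟧ a k c≈a)) (sym (⟦⟧-* a (a ℕ.^ k)))

  K-ι-pow : ∀ k → K (pow ι k)
  K-ι-pow k = [ (λ ι≈2 → 2 ℕ.^ k , pow-⟦⟧ 2 k ι≈2) , (λ ι≈3 → 3 ℕ.^ k , pow-⟦⟧ 3 k ι≈3) ]′ ι≈2⊎3

  -- This is 𝔽₅ˣ ⊆ ⟨ι⟩, checked residue by residue: 3 = 2³, 2 = 3³ and 4 = 2² = 3² modulo 5.
  K-unit : ∀ {c} → K c → ¬ (c ≈ 0#) → ∃[ k ] (c ≈ pow ι k)
  K-unit {c} (n , c≈n) c≉0 = residue (n ℕ.% 5) (ℕ.m%n<n n 5) (trans c≈n (sym (⟦⟧-%5 n)))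
    where
    power : ∀ a k → ι ≈ ⟦ a ⟧ → c ≈ ⟦ (a ℕ.^ k) ℕ.% 5 ⟧ → ∃[ k ] (c ≈ pow ι k)
    power a k ι≈a c≈ = k , trans c≈ (trans (⟦⟧-%5 (a ℕ.^ k)) (sym (pow-⟦⟧ a k ι≈a)))
    residue : ∀ r → r ℕ.< 5 → c ≈ ⟦ r ⟧ → ∃[ k ] (c ≈ pow ι k)
    residue 0 _ c≈r = contradiction c≈r c≉0
    residue 1 _ c≈r = 0 , c≈r
    residue 2 _ c≈r = [ (λ ι≈2 → power 2 1 ι≈2 c≈r) , (λ ι≈3 → power 3 3 ι≈3 c≈r) ]′ ι≈2⊎3
    residue 3 _ c≈r = [ (λ ι≈2 → power 2 3 ι≈2 c≈r) , (λ ι≈3 → power 3 1 ι≈3 c≈r) ]′ ι≈2⊎3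
    residue 4 _ c≈r = [ (λ ι≈2 → power 2 2 ι≈2 c≈r) , (λ ι≈3 → power 3 2 ι≈3 c≈r) ]′ ι≈2⊎3
    residue (suc (suc (suc (suc (suc r))))) r<5 _ = contradiction r<5 (ℕ.m+n≮m 5 r)

  K-inverse : ∀ {c d} → K c → c * d ≈ 1# → K d
  K-inverse {c} {d} Kc cd≈1 =
    let c≉0 = ≉0-factorˡ cd≈1
        (k , c≈ι^k) = K-unit Kc c≉0
    in K-resp (cancelˡ _ _ c≉0 (trans (*-congʳ c≈ι^k) (trans (*-comm _ _) (trans (ι-pow-3* k) (sym cd≈1)))))
         (K-ι-pow (3 ℕ.* k))

  ⟦⟧≉0 : ∀ r → 0 ℕ.< r → r ℕ.< 5 → ¬ (⟦ r ⟧ ≈ 0#)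
  ⟦⟧≉0 0 () _
  ⟦⟧≉0 1 _ _ = 1≉0
  ⟦⟧≉0 2 _ _ = ≉0-factorˡ {b = ⟦ 3 ⟧} (solve 0 (con 2 :* con 3 := con 1) refl)
  ⟦⟧≉0 3 _ _ = ≉0-factorˡ {b = ⟦ 2 ⟧} (solve 0 (con 3 :* con 2 := con 1) refl)
  ⟦⟧≉0 4 _ _ = ≉0-factorˡ {b = ⟦ 4 ⟧} (solve 0 (con 4 :* con 4 := con 1) refl)
  ⟦⟧≉0 (suc (suc (suc (suc (suc r))))) _ r<5 = contradiction r<5 (ℕ.m+n≮m 5 r)

  ⟦⟧-≮ : ∀ {m n} → n ℕ.< 5 → ⟦ m ⟧ ≈ ⟦ n ⟧ → ¬ (m ℕ.< n)
  ⟦⟧-≮ {m} {n} n<5 eq m<n =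
    ⟦⟧≉0 (n ℕ.∸ m) (ℕ.m<n⇒0<n∸m m<n) (ℕ.≤-<-trans (ℕ.m∸n≤m n m) n<5) $ +-cancelˡ ⟦ m ⟧ _ _ $ begin
      ⟦ m ⟧ + ⟦ n ℕ.∸ m ⟧    ≈⟨ ⟦⟧-+ m (n ℕ.∸ m) ⟨
      ⟦ m ℕ.+ (n ℕ.∸ m) ⟧    ≈⟨ ⟦⟧-cong (ℕ.m+[n∸m]≡n (ℕ.<⇒≤ m<n)) ⟩
      ⟦ n ⟧                  ≈⟨ eq ⟨
      ⟦ m ⟧                  ≈⟨ +-identityʳ _ ⟨
      ⟦ m ⟧ + 0#             ∎

  K-size : HasSize _≈_ K 5
  K-size = (λ j → ⟦ toℕ j ⟧) , (λ j → toℕ j , refl) , inj ,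
    λ c (n , c≈n) → n ℕ.mod 5 , (begin
      c                     ≈⟨ c≈n ⟩
      ⟦ n ⟧                 ≈⟨ ⟦⟧-%5 n ⟨
      ⟦ n ℕ.% 5 ⟧           ≈⟨ ⟦⟧-cong (Fin.toℕ-fromℕ< (ℕ.m%n<n n 5)) ⟨
      ⟦ toℕ (n ℕ.mod 5) ⟧   ∎)
    where
    inj : ∀ (i j : Fin 5) → ⟦ toℕ i ⟧ ≈ ⟦ toℕ j ⟧ → i ≡ j
    inj i j eq = Fin.toℕ-injective (ℕ.≤-antisym
      (ℕ.≮⇒≥ (⟦⟧-≮ (Fin.toℕ<n i) (sym eq))) (ℕ.≮⇒≥ (⟦⟧-≮ (Fin.toℕ<n j) eq)))

  -- The discrete logarithm to base ω, reduced modulo N. Since ι = ω^N, it names the coset of `c` in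
  -- Fˣ/⟨ι⟩ = Fˣ/𝔽₅ˣ. The value at 0 is junk.
  log : Carrier → Fin N
  log c with c ≟ 0#
  ... | yes _ = 0 ℕ.mod N
  ... | no c≉0 = proj₁ (generates c c≉0) ℕ.mod N

  log-ω-pow : ∀ {c n} → pow ω n ≈ c → toℕ (log c) ≡ n ℕ.% N
  log-ω-pow {c} {n} ω^n≈c with c ≟ 0#
  ... | yes c≈0 = contradiction (trans ω^n≈c c≈0) (pow-≉0 n ω≉0)
  ... | no c≉0 = let (m , ω^m≈c) = generates c c≉0 in
    ≡.trans (Fin.toℕ-fromℕ< (ℕ.m%n<n m N)) (ω-pow-≈⇒%N m n (trans ω^m≈c (sym ω^n≈c)))

  log-ι : ∀ {c d} k → ¬ (c ≈ 0#) → pow ι k * c ≈ d → log c ≡ log d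
  log-ι {c} {d} k c≉0 eq = let (n , ω^n≈c) = generates c c≉0 in Fin.toℕ-injective $ ≡.trans (log-ω-pow ω^n≈c) $
    ≡.sym $ ≡.trans (log-ω-pow {n = k ℕ.* N ℕ.+ n} (begin
      pow ω (k ℕ.* N ℕ.+ n)          ≈⟨ pow-+ ω (k ℕ.* N) n ⟩
      pow ω (k ℕ.* N) * pow ω n      ≈⟨ *-cong (sym (ι-pow k)) ω^n≈c ⟩
      pow ι k * c                    ≈⟨ eq ⟩
      d                              ∎)) (ℕ.%-remove-+ˡ n (ℕ.n∣m*n k))

  log-injective : ∀ {c d} → ¬ (c ≈ 0#) → ¬ (d ≈ 0#) → log c ≡ log d → ∃[ k ] (pow ι k * c ≈ d)
  log-injective {c} {d} c≉0 d≉0 eq =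
    let (m , ω^m≈c) = generates c c≉0
        (n , ω^n≈d) = generates d d≉0
        m%N≡n%N = ≡.trans (≡.sym (log-ω-pow ω^m≈c)) (≡.trans (≡.cong toℕ eq) (log-ω-pow ω^n≈d))
        s = m ℕ./ N
        t = n ℕ./ N
    -- With m = sN + ρ and n = tN + ρ for the same remainder ρ, the quotient d/c is ι^(t-s), and 3s
    -- replaces -s.
    in t ℕ.+ 3 ℕ.* s , (begin
      pow ι (t ℕ.+ 3 ℕ.* s) * c                                     ≈⟨ *-cong (pow-+ ι t (3 ℕ.* s)) (trans (sym ω^m≈c) (split m)) ⟩
      pow ι t * pow ι (3 ℕ.* s) * (pow ι s * pow ω (m ℕ.% N))       ≈⟨ solve 4 (λ a b c d → a :* b :* (c :* d) := (b :* c) :* (a :* d)) refl _ _ _ _ ⟩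
      pow ι (3 ℕ.* s) * pow ι s * (pow ι t * pow ω (m ℕ.% N))       ≈⟨ *-cong (ι-pow-3* s) (*-congˡ (pow-≡ ω m%N≡n%N)) ⟩
      1# * (pow ι t * pow ω (n ℕ.% N))                              ≈⟨ *-identityˡ _ ⟩
      pow ι t * pow ω (n ℕ.% N)                                     ≈⟨ split n ⟨
      pow ω n                                                       ≈⟨ ω^n≈d ⟩
      d                                                             ∎)
    where
    split : ∀ n → pow ω n ≈ pow ι (n ℕ./ N) * pow ω (n ℕ.% N)
    split n = begin
      pow ω n                                          ≈⟨ pow-≡ ω (≡.trans (ℕ.m≡m%n+[m/n]*n n N) (ℕ.+-comm (n ℕ.% N) _)) ⟩
      pow ω (n ℕ./ N ℕ.* N ℕ.+ n ℕ.% N)                ≈⟨ pow-+ ω (n ℕ./ N ℕ.* N) _ ⟩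
      pow ω (n ℕ./ N ℕ.* N) * pow ω (n ℕ.% N)          ≈⟨ *-congʳ (ι-pow (n ℕ./ N)) ⟨
      pow ι (n ℕ./ N) * pow ω (n ℕ.% N)                ∎

  log-surjective : ∀ j → log (pow ω (toℕ j)) ≡ j
  log-surjective j = Fin.toℕ-injective (≡.trans (log-ω-pow {n = toℕ j} refl) (ℕ.m<n⇒m%n≡m (Fin.toℕ<n j)))

  log-1 : toℕ (log 1#) ≡ 0
  log-1 = ≡.trans (log-ω-pow {n = 0} refl) (ℕ.m<n⇒m%n≡m (ℕ.>-nonZero⁻¹ N))

  -- Vectors, points and determinants.

  infix 4 _≋_
  _≋_ : Vec2 → Vec2 → Set
  (x , y) ≋ (x' , y') = (x ≈ x') × (y ≈ y')

  ≋-isEquivalence : IsEquivalence _≋_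
  ≋-isEquivalence = record
    { refl = refl , refl
    ; sym = λ (e , e') → sym e , sym e'
    ; trans = λ (e , e') (f , f') → trans e f , trans e' f' }

  open IsEquivalence ≋-isEquivalence using () renaming (refl to ≋-refl; sym to ≋-sym; trans to ≋-trans)

  scale : Carrier → Vec2 → Vec2
  scale c (x , y) = c * x , c * y

  scale-cong : ∀ {c c' p p'} → c ≈ c' → p ≋ p' → scale c p ≋ scale c' p'
  scale-cong c≈c' (e , e') = *-cong c≈c' e , *-cong c≈c' e'

  scale-scale : ∀ c c' p → scale c (scale c' p) ≋ scale (c * c') p
  scale-scale c c' (x , y) = sym (*-assoc c c' x) , sym (*-assoc c c' y)

  scale-1 : ∀ p → scale 1# p ≋ p
  scale-1 (x , y) = *-identityˡ x , *-identityˡ y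

  scale-inverse : ∀ {c c' p p'} → c' * c ≈ 1# → scale c p ≋ p' → scale c' p' ≋ p
  scale-inverse {p = p} c'c≈1 eq = ≋-trans (scale-cong refl (≋-sym eq))
    (≋-trans (scale-scale _ _ p) (≋-trans (scale-cong c'c≈1 ≋-refl) (scale-1 p)))

  IsPt-≋ : ∀ {p p'} → p ≋ p' → IsPt p → IsPt p'
  IsPt-≋ (e , e') pt (z , z') = pt (trans e z , trans e' z')

  IsPt-scale : ∀ {c p} → ¬ (c ≈ 0#) → IsPt p → IsPt (scale c p)
  IsPt-scale c≉0 pt (z , z') = pt (factor z , factor z')
    where
    factor : ∀ {x} → _ * x ≈ 0# → x ≈ 0#
    factor eq = [ (λ c≈0 → contradiction c≈0 c≉0) , id ]′ (zero-divisor eq)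

  -- Points are compared with exponents below 4; reduction modulo 4 admits arbitrary exponents such
  -- as 3k or k + l.
  ι-scale⇒~ : ∀ {p p'} k → scale (pow ι k) p ≋ p' → p ~ p'
  ι-scale⇒~ {p} k eq = k ℕ.mod 4 , ≋-trans (scale-cong
    (trans (pow-≡ ι (Fin.toℕ-fromℕ< (ℕ.m%n<n k 4))) (pow-% 4 k ι⁴≈1)) ≋-refl) eq

  ≋⇒~ : ∀ {p p'} → p ≋ p' → p ~ p'
  ≋⇒~ {p} eq = ι-scale⇒~ 0 (≋-trans (scale-1 p) eq)

  ~-isEquivalence : IsEquivalence _~_
  ~-isEquivalence = record
    { refl = ≋⇒~ ≋-refl
    ; sym = λ {p} {p'} (k , eq) → ι-scale⇒~ (3 ℕ.* toℕ k) (scale-inverse {p = p} {p'} (ι-pow-3* (toℕ k)) eq)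
    ; trans = λ {p} {p'} {p″} (k , eq) (l , eq') → ι-scale⇒~ (toℕ l ℕ.+ toℕ k)
        (≋-trans (≋-trans (scale-cong (pow-+ ι (toℕ l) (toℕ k)) ≋-refl) (≋-sym (scale-scale _ _ p)))
          (≋-trans (scale-cong refl eq) eq')) }

  open IsEquivalence ~-isEquivalence using () renaming (refl to ~-refl; sym to ~-sym; trans to ~-trans)

  _~?_ : Decidable _~_
  (x , y) ~? (x' , y') = Fin.any? λ k → ((pow ι (toℕ k) * x) ≟ x') ×-dec ((pow ι (toℕ k) * y) ≟ y')

  IsPt-~ : ∀ {p p'} → p ~ p' → IsPt p → IsPt p'
  IsPt-~ (k , eq) pt = IsPt-≋ eq (IsPt-scale (pow-≉0 (toℕ k) ι≉0) pt)

  -- The scalars stand on the right so that the action of a matrix on (s, t) is definitionally this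
  -- combination of its columns.
  combination : Carrier → Vec2 → Carrier → Vec2 → Vec2
  combination s (x , x') t (y , y') = x * s + y * t , x' * s + y' * t

  combination-cong : ∀ {s u t v s' u' t' v'} → s ≈ s' → u ≋ u' → t ≈ t' → v ≋ v' →
    combination s u t v ≋ combination s' u' t' v'
  combination-cong es (e , e') et (f , f') =
    +-cong (*-cong e es) (*-cong f et) , +-cong (*-cong e' es) (*-cong f' et)

  det : Vec2 → Vec2 → Carrier
  det (x , x') (y , y') = x * y' + - (y * x')

  det-cong : ∀ {p p' r r'} → p ≋ p' → r ≋ r' → det p r ≈ det p' r'
  det-cong (e , e') (f , f') = +-cong (*-cong e f') (-‿cong (*-cong f e'))

  det-scale : ∀ c p d r → det (scale c p) (scale d r) ≈ (c * d) * det p r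
  det-scale c (x , x') d (y , y') = solve 6 (λ c d x x' y y' →
    (c :* x) :* (d :* y') :+ :- ((d :* y) :* (c :* x')) := (c :* d) :* (x :* y' :+ :- (y :* x'))) refl c d x x' y y'

  det-scaleʳ : ∀ p d r → det p (scale d r) ≈ d * det p r
  det-scaleʳ p d r = trans (det-cong (≋-sym (scale-1 p)) ≋-refl)
    (trans (det-scale 1# p d r) (*-congʳ (*-identityˡ d)))

  -- Cramer's rule, from the identity det(u,v) w = det(w,v) u + det(u,w) v; `e` is the inverse of
  -- det(u,v).
  cramer : ∀ {e} u v w → e * det u v ≈ 1# → w ≋ combination (e * det w v) u (e * det u w) v
  cramer {e} u@(u₁ , u₂) v@(v₁ , v₂) w@(w₁ , w₂) e*det≈1 = coordinate w₁ first , coordinate w₂ second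
    where
    coordinate : ∀ x {y} → (e * det u v) * x ≈ y → x ≈ y
    coordinate x eq = trans (sym (trans (*-congʳ e*det≈1) (*-identityˡ x))) eq
    first = solve 7 (λ e u₁ u₂ v₁ v₂ w₁ w₂ →
      (e :* (u₁ :* v₂ :+ :- (v₁ :* u₂))) :* w₁ :=
      u₁ :* (e :* (w₁ :* v₂ :+ :- (v₁ :* w₂))) :+ v₁ :* (e :* (u₁ :* w₂ :+ :- (w₁ :* u₂)))) refl e u₁ u₂ v₁ v₂ w₁ w₂
    second = solve 7 (λ e u₁ u₂ v₁ v₂ w₁ w₂ →
      (e :* (u₁ :* v₂ :+ :- (v₁ :* u₂))) :* w₂ :=
      u₂ :* (e :* (w₁ :* v₂ :+ :- (v₁ :* w₂))) :+ v₂ :* (e :* (u₁ :* w₂ :+ :- (w₁ :* u₂)))) refl e u₁ u₂ v₁ v₂ w₁ w₂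

  -- The zero vector gets the junk value (0 , 0).
  complement : Vec2 → Vec2
  complement (x , y) with x ≟ 0# | y ≟ 0#
  ... | no x≉0 | _ = 0# , proj₁ (inverse x x≉0)
  ... | yes _ | no y≉0 = - proj₁ (inverse y y≉0) , 0#
  ... | yes _ | yes _ = 0# , 0#

  det-complement : ∀ p → IsPt p → det p (complement p) ≈ 1#
  det-complement (x , y) pt with x ≟ 0# | y ≟ 0#
  ... | no x≉0 | _ = trans (solve 3 (λ x y z → x :* z :+ :- (con 0 :* y) := x :* z) refl x y _) (proj₂ (inverse x x≉0))
  ... | yes _ | no y≉0 = trans (solve 3 (λ x y z → x :* con 0 :+ :- ((:- z) :* y) := y :* z) refl x y _) (proj₂ (inverse y y≉0))
  ... | yes x≈0 | yes y≈0 = contradiction (x≈0 , y≈0) pt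

  -- If r = c p, then det(r, p') = c det(p, p') = c for p' the complement of p, so the factor c is
  -- read off without choosing a nonzero coordinate again.
  ratio : Vec2 → Vec2 → Carrier
  ratio p r = det r (complement p)

  -- Cramer's rule in the basis formed by p and its complement: the second coefficient is det(p, r)
  -- = 0.
  parallel : ∀ {p r} → IsPt p → det p r ≈ 0# → r ≋ scale (ratio p r) p
  parallel {p} {r} pt det≈0 = ≋-trans
    (cramer {1#} p (complement p) r (trans (*-identityˡ _) (det-complement p pt)))
    (drop (trans (*-identityˡ _) det≈0))
    where
    drop : ∀ {s t} → t ≈ 0# → combination (1# * s) p t (complement p) ≋ scale s p
    drop {s} t≈0 = component _ _ , component _ _
      where
      component : ∀ x y → x * (1# * s) + y * _ ≈ s * x
      component x y = trans (+-congˡ (trans (*-congˡ t≈0) (zeroʳ y)))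
        (solve 2 (λ x s → x :* (con 1 :* s) :+ con 0 := s :* x) refl x s)

  ratio-scale : ∀ {c p r} → IsPt p → r ≋ scale c p → ratio p r ≈ c
  ratio-scale {c} {p} {r} pt eq = begin
    det r (complement p)                           ≈⟨ det-cong eq (≋-sym (scale-1 (complement p))) ⟩
    det (scale c p) (scale 1# (complement p))      ≈⟨ det-scale c p 1# (complement p) ⟩
    (c * 1#) * det p (complement p)                ≈⟨ *-cong (*-identityʳ c) (det-complement p pt) ⟩
    c * 1#                                         ≈⟨ *-identityʳ c ⟩
    c                                              ∎

  ratio-≉0 : ∀ {p r} → IsPt r → r ≋ scale (ratio p r) p → ¬ (ratio p r ≈ 0#)
  ratio-≉0 pt (e , e') c≈0 = pt (trans e (trans (*-congʳ c≈0) (zeroˡ _)) , trans e' (trans (*-congʳ c≈0) (zeroˡ _)))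

  -- The action of SL(2, F).

  act-cong : ∀ g {p p'} → p ≋ p' → act g p ≋ act g p'
  act-cong g (e , e') = +-cong (*-congˡ e) (*-congˡ e') , +-cong (*-congˡ e) (*-congˡ e')

  act-scale : ∀ g c p → act g (scale c p) ≋ scale c (act g p)
  act-scale g c (x , y) = component (SL.a g) (SL.b g) , component (SL.c g) (SL.d g)
    where
    component : ∀ a b → a * (c * x) + b * (c * y) ≈ c * (a * x + b * y)
    component a b = solve 5 (λ a b c x y → a :* (c :* x) :+ b :* (c :* y) := c :* (a :* x :+ b :* y)) refl a b c x y

  act-combination : ∀ g s u t v → act g (combination s u t v) ≋ combination s (act g u) t (act g v)
  act-combination g s (u₁ , u₂) t (v₁ , v₂) = component (SL.a g) (SL.b g) , component (SL.c g) (SL.d g)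
    where
    component : ∀ a b → a * (u₁ * s + v₁ * t) + b * (u₂ * s + v₂ * t) ≈ (a * u₁ + b * u₂) * s + (a * v₁ + b * v₂) * t
    component a b = solve 8 (λ a b s t u₁ u₂ v₁ v₂ → a :* (u₁ :* s :+ v₁ :* t) :+ b :* (u₂ :* s :+ v₂ :* t) :=
      (a :* u₁ :+ b :* u₂) :* s :+ (a :* v₁ :+ b :* v₂) :* t) refl a b s t u₁ u₂ v₁ v₂

  det-act : ∀ g p r → det (act g p) (act g r) ≈ det p r
  det-act g (x , x') (y , y') = trans (solve 8 (λ a b c d x x' y y' →
    (a :* x :+ b :* x') :* (c :* y :+ d :* y') :+ :- ((a :* y :+ b :* y') :* (c :* x :+ d :* x')) :=
    (a :* d :+ :- (b :* c)) :* (x :* y' :+ :- (y :* x'))) refl (SL.a g) (SL.b g) (SL.c g) (SL.d g) x x' y y')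
    (trans (*-congʳ (SL.det g)) (*-identityˡ _))

  act-~ : ∀ g {p p'} → p ~ p' → act g p ~ act g p'
  act-~ g {p} (k , eq) = ι-scale⇒~ (toℕ k) (≋-trans (≋-sym (act-scale g _ p)) (act-cong g eq))

  fromColumns : ∀ p r → det p r ≈ 1# → SL
  fromColumns (x , x') (y , y') det≈1 = record { a = x ; b = y ; c = x' ; d = y' ; det = det≈1 }

  infixr 9 _∙_
  _∙_ : SL → SL → SL
  g ∙ h = fromColumns (act g (SL.a h , SL.c h)) (act g (SL.b h , SL.d h)) (trans (det-act g _ _) (SL.det h))

  act-∙ : ∀ g h p → act (g ∙ h) p ≋ act g (act h p)
  act-∙ g h (x , y) = ≋-sym (act-combination g x (SL.a h , SL.c h) y (SL.b h , SL.d h))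

  e₁ e₂ : Vec2
  e₁ = 1# , 0#
  e₂ = 0# , 1#

  act-e₁ : ∀ g → act g e₁ ≋ (SL.a g , SL.c g)
  act-e₁ g = component _ _ , component _ _
    where
    component : ∀ a b → a * 1# + b * 0# ≈ a
    component = solve 2 (λ a b → a :* con 1 :+ b :* con 0 := a) refl

  act-e₂ : ∀ g → act g e₂ ≋ (SL.b g , SL.d g)
  act-e₂ g = component _ _ , component _ _
    where
    component : ∀ a b → a * 0# + b * 1# ≈ b
    component = solve 2 (λ a b → a :* con 0 :+ b :* con 1 := b) refl

  infix 10 _⁻¹
  _⁻¹ : SL → SL
  g ⁻¹ = record { a = SL.d g ; b = - SL.b g ; c = - SL.c g ; d = SL.a g
                ; det = trans (solve 4 (λ a b c d → d :* a :+ :- ((:- b) :* (:- c)) := a :* d :+ :- (b :* c)) refl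
                          (SL.a g) (SL.b g) (SL.c g) (SL.d g)) (SL.det g) }

  act-⁻¹ : ∀ g p → act (g ⁻¹) (act g p) ≋ p
  act-⁻¹ g (x , y) = trans (solve 6 (λ a b c d x y → d :* (a :* x :+ b :* y) :+ (:- b) :* (c :* x :+ d :* y) :=
      (a :* d :+ :- (b :* c)) :* x) refl (SL.a g) (SL.b g) (SL.c g) (SL.d g) x y) (trans (*-congʳ (SL.det g)) (*-identityˡ x)) ,
    trans (solve 6 (λ a b c d x y → (:- c) :* (a :* x :+ b :* y) :+ a :* (c :* x :+ d :* y) :=
      (a :* d :+ :- (b :* c)) :* y) refl (SL.a g) (SL.b g) (SL.c g) (SL.d g) x y) (trans (*-congʳ (SL.det g)) (*-identityˡ y))

  act-~⁻¹ : ∀ g p p' → act g p ~ act g p' → p ~ p'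
  act-~⁻¹ g u v gu~gv = ~-trans {u} {act (g ⁻¹) (act g u)} {v}
    (≋⇒~ {u} {act (g ⁻¹) (act g u)} (≋-sym (act-⁻¹ g u)))
    (~-trans {act (g ⁻¹) (act g u)} {act (g ⁻¹) (act g v)} {v} (act-~ (g ⁻¹) {act g u} {act g v} gu~gv)
      (≋⇒~ {act (g ⁻¹) (act g v)} {v} (act-⁻¹ g v)))

  act-⁻¹ʳ : ∀ g p → act g (act (g ⁻¹) p) ≋ p
  act-⁻¹ʳ g (x , y) = trans (solve 6 (λ a b c d x y → a :* (d :* x :+ (:- b) :* y) :+ b :* ((:- c) :* x :+ a :* y) :=
      (a :* d :+ :- (b :* c)) :* x) refl (SL.a g) (SL.b g) (SL.c g) (SL.d g) x y) (trans (*-congʳ (SL.det g)) (*-identityˡ x)) ,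
    trans (solve 6 (λ a b c d x y → c :* (d :* x :+ (:- b) :* y) :+ d :* ((:- c) :* x :+ a :* y) :=
      (a :* d :+ :- (b :* c)) :* y) refl (SL.a g) (SL.b g) (SL.c g) (SL.d g) x y) (trans (*-congʳ (SL.det g)) (*-identityˡ y))

  IsPt-act : ∀ g {p} → IsPt p → IsPt (act g p)
  IsPt-act g {p} pt (z , z') = pt (≋-trans (≋-sym (act-⁻¹ g p)) (≋-trans (act-cong (g ⁻¹) (z , z'))
    (component _ _ , component _ _)))
    where
    component : ∀ a b → a * 0# + b * 0# ≈ 0#
    component = solve 2 (λ a b → a :* con 0 :+ b :* con 0 := con 0) refl

  -- The lattice 𝔽₅², the points of `T`, and blocks as lattice translates.

  K² : Vec2 → Set
  K² (x , y) = K x × K y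

  K-0 : K 0#
  K-0 = 0 , refl

  K-1 : K 1#
  K-1 = 1 , refl

  K-det : ∀ {u v} → K² u → K² v → K (det u v)
  K-det (Kx , Kx') (Ky , Ky') = K-+ (K-* Kx Ky') (K-neg (K-* Ky Kx'))

  K²-scale : ∀ {c p} → K c → K² p → K² (scale c p)
  K²-scale Kc (Kx , Ky) = K-* Kc Kx , K-* Kc Ky

  K²-combination : ∀ {s u t v} → K s → K² u → K t → K² v → K² (combination s u t v)
  K²-combination Ks (Kx , Kx') Kt (Ky , Ky') = K-+ (K-* Kx Ks) (K-* Ky Kt) , K-+ (K-* Kx' Ks) (K-* Ky' Kt)

  K²-complement : ∀ {p} → K² p → K² (complement p)
  K²-complement {x , y} (Kx , Ky) with x ≟ 0# | y ≟ 0#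
  ... | no x≉0 | _ = K-0 , K-inverse Kx (proj₂ (inverse x x≉0))
  ... | yes _ | no y≉0 = K-neg (K-inverse Ky (proj₂ (inverse y y≉0))) , K-0
  ... | yes _ | yes _ = K-0 , K-0

  K-ι : K ι
  K-ι = K-resp (*-identityʳ ι) (K-ι-pow 1)

  T-K² : ∀ j → K² (T j)
  T-K² zero = K-1 , K-0
  T-K² (suc zero) = K-0 , K-1
  T-K² (suc (suc zero)) = K-1 , K-1
  T-K² (suc (suc (suc zero))) = K-+ K-1 K-ι , K-1
  T-K² (suc (suc (suc (suc zero)))) = K-ι , K-1
  T-K² (suc (suc (suc (suc (suc zero))))) = K-1 , K-+ K-1 (K-neg K-ι)

  T-IsPt : ∀ j → IsPt (T j)
  T-IsPt zero (z , _) = 1≉0 z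
  T-IsPt (suc zero) (_ , z) = 1≉0 z
  T-IsPt (suc (suc zero)) (_ , z) = 1≉0 z
  T-IsPt (suc (suc (suc zero))) (_ , z) = 1≉0 z
  T-IsPt (suc (suc (suc (suc zero)))) (_ , z) = 1≉0 z
  T-IsPt (suc (suc (suc (suc (suc zero))))) (z , _) = 1≉0 z

  -- For ι = 2 the last four entries of `T` are the points (c, 1) with c = 1, 3, 2, 4, the last
  -- because 4 (4, 1) = (1, 4) = (1, 1 - ι). For ι = 3 they have c = 1, 4, 3, 2, the last because 3
  -- (2, 1) = (1, 3) = (1, 1 - ι).
  affine-T : ∀ {c} → K c → ∃[ j ] ((c , 1#) ~ T j)
  affine-T {c} (n , c≈n) = residue (n ℕ.% 5) (ℕ.m%n<n n 5) (trans c≈n (sym (⟦⟧-%5 n)))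
    where
    equal : ∀ j → (c , 1#) ≋ T j → ∃[ j ] ((c , 1#) ~ T j)
    equal j eq = j , ≋⇒~ {c , 1#} {T j} eq
    scaled : ∀ a k → ι ≈ ⟦ a ⟧ → ⟦ a ℕ.^ k ⟧ * c ≈ 1# → ⟦ a ℕ.^ k ⟧ * 1# ≈ 1# + - ⟦ a ⟧ → ∃[ j ] ((c , 1#) ~ T j)
    scaled a k ι≈a eq eq' = suc (suc (suc (suc (suc zero)))) , ι-scale⇒~ {c , 1#} {1# , 1# + - ι} k
      (trans (*-congʳ (pow-⟦⟧ a k ι≈a)) eq , trans (*-congʳ (pow-⟦⟧ a k ι≈a)) (trans eq' (+-congˡ (-‿cong (sym ι≈a)))))
    residue : ∀ r → r ℕ.< 5 → c ≈ ⟦ r ⟧ → ∃[ j ] ((c , 1#) ~ T j)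
    residue 0 _ c≈0 = equal (suc zero) (c≈0 , refl)
    residue 1 _ c≈1 = equal (suc (suc zero)) (c≈1 , refl)
    residue 2 _ c≈2 = [ (λ ι≈2 → equal (suc (suc (suc (suc zero)))) (trans c≈2 (sym ι≈2) , refl))
      , (λ ι≈3 → scaled 3 1 ι≈3 (trans (*-congˡ c≈2) (solve 0 (con 3 :* con 2 := con 1) refl))
                                 (solve 0 (con 3 :* con 1 := con 1 :+ :- con 3) refl)) ]′ ι≈2⊎3
    residue 3 _ c≈3 = [ (λ ι≈2 → equal (suc (suc (suc zero)))
                          (trans c≈3 (trans (solve 0 (con 3 := con 1 :+ con 2) refl) (+-congˡ (sym ι≈2))) , refl))
      , (λ ι≈3 → equal (suc (suc (suc (suc zero)))) (trans c≈3 (sym ι≈3) , refl)) ]′ ι≈2⊎3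
    residue 4 _ c≈4 = [ (λ ι≈2 → scaled 2 2 ι≈2 (trans (*-congˡ c≈4) (solve 0 (con 4 :* con 4 := con 1) refl))
                                 (solve 0 (con 4 :* con 1 := con 1 :+ :- con 2) refl))
      , (λ ι≈3 → equal (suc (suc (suc zero)))
          (trans c≈4 (trans (solve 0 (con 4 := con 1 :+ con 3) refl) (+-congˡ (sym ι≈3))) , refl)) ]′ ι≈2⊎3
    residue (suc (suc (suc (suc (suc r))))) r<5 _ = contradiction r<5 (ℕ.m+n≮m 5 r)

  K²-T : ∀ {u} → IsPt u → K² u → ∃[ j ] (u ~ T j)
  K²-T {a , b} pt (Ka , Kb) with b ≟ 0#
  ... | yes b≈0 = let (k , a≈ι^k) = K-unit Ka (λ a≈0 → pt (a≈0 , b≈0))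
    in zero , ι-scale⇒~ {a , b} {1# , 0#} (3 ℕ.* k)
      (trans (*-congˡ a≈ι^k) (ι-pow-3* k) , trans (*-congˡ b≈0) (zeroʳ _))
  ... | no b≉0 = let (k , b≈ι^k) = K-unit Kb b≉0
                     c           = pow ι (3 ℕ.* k) * a
                     (j , eq)    = affine-T {c} (K-* (K-ι-pow (3 ℕ.* k)) Ka)
    in j , ~-trans {a , b} {c , 1#} {T j}
      (ι-scale⇒~ {a , b} {c , 1#} (3 ℕ.* k) (refl , trans (*-congˡ b≈ι^k) (ι-pow-3* k))) eq

  -- The block gT consists of the points with representatives in the lattice g 𝔽₅².
  InB⇒K² : ∀ g p → InB g p → ∃[ u ] (IsPt u × K² u × p ≋ act g u)
  InB⇒K² g p (j , k , eq) = scale c (T j) ,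
    IsPt-scale (pow-≉0 (3 ℕ.* toℕ k) ι≉0) (T-IsPt j) , K²-scale (K-ι-pow (3 ℕ.* toℕ k)) (T-K² j) ,
    ≋-sym (≋-trans (act-scale g c (T j)) (scale-inverse {p = p} (ι-pow-3* (toℕ k)) eq))
    where c = pow ι (3 ℕ.* toℕ k)

  K²⇒InB : ∀ g p u → IsPt u → K² u → p ≋ act g u → InB g p
  K²⇒InB g p u pt Ku eq = let (j , u~Tj) = K²-T {u} pt Ku in
    j , ~-trans {p} {act g u} {act g (T j)} (≋⇒~ eq) (act-~ g {u} {T j} u~Tj)

  InB⇒IsPt : ∀ g p → InB g p → IsPt p
  InB⇒IsPt g p p∈g = let (u , pt , _ , p≋gu) = InB⇒K² g p p∈g in IsPt-≋ (≋-sym p≋gu) (IsPt-act g pt)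

  InB-~ : ∀ g p p' → p ~ p' → InB g p → InB g p'
  InB-~ g p p' p~p' (j , p~) = j , ~-trans {p'} {p} {act g (T j)} (~-sym {p} {p'} p~p') p~

  InB? : ∀ g p → Dec (InB g p)
  InB? g p = Fin.any? λ j → p ~? act g (T j)

  -- Two points in a common block.

  ≈B-isEquivalence : IsEquivalence _≈B_
  ≈B-isEquivalence = record
    { refl = λ _ _ → id , id
    ; sym = λ eq p pt → proj₂ (eq p pt) , proj₁ (eq p pt)
    ; trans = λ eq eq' p pt → proj₁ (eq' p pt) ∘ proj₁ (eq p pt) , proj₂ (eq p pt) ∘ proj₂ (eq' p pt) }

  -- The matrix g preserves determinants, and on 𝔽₅² they lie in 𝔽₅.
  common-block⇒K-det : ∀ g x y → InB g x → InB g y → K (det x y)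
  common-block⇒K-det g x y x∈g y∈g =
    let (u , _ , Ku , x≋gu) = InB⇒K² g x x∈g
        (v , _ , Kv , y≋gv) = InB⇒K² g y y∈g
    in K-resp (sym (trans (det-cong x≋gu y≋gv) (det-act g u v))) (K-det {u} {v} Ku Kv)

  -- Proportional vectors of 𝔽₅² have their ratio in 𝔽₅, because the complement of an 𝔽₅-vector is
  -- again one; a nonzero ratio is then a power of ι.
  common-block⇒~ : ∀ g x y → InB g x → InB g y → det x y ≈ 0# → x ~ y
  common-block⇒~ g x y x∈g y∈g det≈0 =
    let (u , ptu , Ku , x≋gu) = InB⇒K² g x x∈g
        (v , ptv , Kv , y≋gv) = InB⇒K² g y y∈g
        v≋cu : v ≋ scale (ratio u v) u
        v≋cu = parallel ptu (trans (sym (trans (det-cong x≋gu y≋gv) (det-act g u v))) det≈0)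
        (k , c≈ι^k) = K-unit (K-det {v} {complement u} Kv (K²-complement {u} Ku)) (ratio-≉0 {u} {v} ptv v≋cu)
        u~v : u ~ v
        u~v = ι-scale⇒~ k (≋-trans (scale-cong (sym c≈ι^k) ≋-refl) (≋-sym v≋cu))
    in ~-trans {x} {act g u} {y} (≋⇒~ x≋gu) (~-trans {act g u} {act g v} {y}
         (act-~ g {u} {v} u~v) (≋⇒~ (≋-sym y≋gv)))

  -- By Cramer's rule the coordinates of p in the basis x, y are quotients of determinants of points
  -- of g, hence lie in 𝔽₅. As x and y belong to the lattice of h, so does p.
  block-⊆ : ∀ g h x y → ¬ (det x y ≈ 0#) → InB g x → InB g y → InB h x → InB h y → ∀ p → InB g p → InB h p
  block-⊆ g h x y det≉0 x∈g y∈g x∈h y∈h p p∈g =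
    let (e , det*e≈1) = inverse (det x y) det≉0
        Ke = K-inverse (common-block⇒K-det g x y x∈g y∈g) det*e≈1
        (u , _ , Ku , x≋hu) = InB⇒K² h x x∈h
        (v , _ , Kv , y≋hv) = InB⇒K² h y y∈h
        s = e * det p y
        t = e * det x p
        w = combination s u t v
        p≋hw : p ≋ act h w
        p≋hw = ≋-trans (cramer x y p (trans (*-comm e _) det*e≈1))
          (≋-trans (combination-cong refl x≋hu refl y≋hv) (≋-sym (act-combination h s u t v)))
        Kw : K² w
        Kw = K²-combination {s} {u} {t} {v} (K-* Ke (common-block⇒K-det g p y p∈g y∈g)) Ku
               (K-* Ke (common-block⇒K-det g x p x∈g p∈g)) Kv
    in K²⇒InB h p w (IsPt-≋ (act-⁻¹ h w) (IsPt-act (h ⁻¹) (IsPt-≋ p≋hw (InB⇒IsPt g p p∈g)))) Kw p≋hw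

  block-unique : ∀ g h x y → ¬ (det x y ≈ 0#) → InB g x → InB g y → InB h x → InB h y → g ≈B h
  block-unique g h x y det≉0 x∈g y∈g x∈h y∈h p _ =
    block-⊆ g h x y det≉0 x∈g y∈g x∈h y∈h p , block-⊆ h g x y det≉0 x∈h y∈h x∈g y∈g p

  1≈⇒≉0 : ∀ {c} → c ≈ 1# → ¬ (c ≈ 0#)
  1≈⇒≉0 c≈1 c≈0 = 1≉0 (trans (sym c≈1) c≈0)

  column₁∈ : ∀ x y (det≈1 : det x y ≈ 1#) → InB (fromColumns x y det≈1) x
  column₁∈ x y det≈1 = zero , ≋⇒~ {x} {act (fromColumns x y det≈1) e₁} (≋-sym (act-e₁ (fromColumns x y det≈1)))

  column₂∈ : ∀ x y (det≈1 : det x y ≈ 1#) → InB (fromColumns x y det≈1) y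
  column₂∈ x y det≈1 = suc zero , ≋⇒~ {y} {act (fromColumns x y det≈1) e₂} (≋-sym (act-e₂ (fromColumns x y det≈1)))

  det-e₁-e₂ : ∀ g → ¬ (det (act g e₁) (act g e₂) ≈ 0#)
  det-e₁-e₂ g = 1≈⇒≉0 (trans (det-act g e₁ e₂) (solve 0 (con 1 :* con 1 :+ :- (con 0 :* con 0) := con 1) refl))

  act-T∈ : ∀ g j → InB g (act g (T j))
  act-T∈ g j = j , ~-refl {act g (T j)}

  -- Block equality quantifies over all points, but it is settled by whether h contains the two
  -- independent points g e₁ and g e₂.
  _≈B?_ : Decidable _≈B_
  g ≈B? h = Dec.map′
    (λ (e₁∈ , e₂∈) → block-unique g h (act g e₁) (act g e₂) (det-e₁-e₂ g)
      (act-T∈ g zero) (act-T∈ g (suc zero)) e₁∈ e₂∈)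
    (λ eq → proj₁ (eq (act g e₁) (IsPt-act g (T-IsPt zero))) (act-T∈ g zero) ,
            proj₁ (eq (act g e₂) (IsPt-act g (T-IsPt (suc zero)))) (act-T∈ g (suc zero)))
    (InB? h (act g e₁) ×-dec InB? h (act g e₂))

  -- The columns must have determinant 1, so y is divided by δ = det(x, y). Since δ is a power of ι,
  -- this does not change the point that y represents.
  common-blocks : ∀ x y → K (det x y) → ¬ (det x y ≈ 0#) → HasSize _≈B_ (λ B → InB B x × InB B y) 1
  common-blocks x y Kδ δ≉0 = (λ _ → B) , (λ _ → x∈B , y∈B) , (λ { zero zero _ → ≡.refl }) ,
    λ h (x∈h , y∈h) → zero , block-unique h B x y δ≉0 x∈h y∈h x∈B y∈B
    where
    δ = det x y
    e = proj₁ (inverse δ δ≉0)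
    det≈1 : det x (scale e y) ≈ 1#
    det≈1 = trans (det-scaleʳ x e y) (trans (*-comm e δ) (proj₂ (inverse δ δ≉0)))
    B = fromColumns x (scale e y) det≈1
    x∈B = column₁∈ x (scale e y) det≈1
    y∈B : InB B y
    y∈B = let (k , δ≈ι^k) = K-unit Kδ δ≉0 in
      InB-~ B (scale e y) y (ι-scale⇒~ {scale e y} {y} k (≋-trans (scale-scale _ e y) (≋-trans
        (scale-cong (trans (*-congʳ (sym δ≈ι^k)) (proj₂ (inverse δ δ≉0))) ≋-refl) (scale-1 y)))) (column₂∈ x (scale e y) det≈1)

  -- The scheme has m + 1 = 2N relations: index 2i for the pairs with y = c x and log c = i,
  -- index 2i + 1 for those with det x y ≠ 0 and log (det x y) = i.
  module Classification (m : ℕ) (N*2≡1+m : N ℕ.* 2 ≡ suc m) where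

    code : Fin N → Fin 2 → Fin (suc m)
    code i b = Fin.cast N*2≡1+m (combine i b)

    toℕ-code : ∀ i b → toℕ (code i b) ≡ 2 ℕ.* toℕ i ℕ.+ toℕ b
    toℕ-code i b = ≡.trans (Fin.toℕ-cast N*2≡1+m (combine i b)) (Fin.toℕ-combine i b)

    code-injective : ∀ i b i' b' → code i b ≡ code i' b' → i ≡ i' × b ≡ b'
    code-injective i b i' b' eq = Fin.combine-injective i b i' b' (Fin.toℕ-injective (≡.trans
      (≡.sym (Fin.toℕ-cast N*2≡1+m (combine i b)))
      (≡.trans (≡.cong toℕ eq) (Fin.toℕ-cast N*2≡1+m (combine i' b')))))

    code-surjective : ∀ j → ∃[ i ] ∃[ b ] (code i b ≡ j)
    code-surjective j = let (i , b) = remQuot 2 (Fin.cast (≡.sym N*2≡1+m) j) in i , b ,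
      ≡.trans (≡.cong (Fin.cast N*2≡1+m) (Fin.combine-remQuot {N} 2 _)) (Fin.cast-involutive N*2≡1+m (≡.sym N*2≡1+m) j)

    -- The decision is an argument so that `cls` can be evaluated by cases on an arbitrary decision.
    classify : ∀ x y → Dec (det x y ≈ 0#) → Fin (suc m)
    classify x y (yes _) = code (log (ratio x y)) zero
    classify x y (no _) = code (log (det x y)) (suc zero)

    cls : Vec2 → Vec2 → Fin (suc m)
    cls x y = classify x y (det x y ≟ 0#)

    cls-dependent : ∀ x y → det x y ≈ 0# → cls x y ≡ code (log (ratio x y)) zero
    cls-dependent x y det≈0 = case (det x y ≟ 0#)
      where
      case : ∀ d → classify x y d ≡ code (log (ratio x y)) zero
      case (yes _) = ≡.refl
      case (no det≉0) = contradiction det≈0 det≉0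

    cls-independent : ∀ x y → ¬ (det x y ≈ 0#) → cls x y ≡ code (log (det x y)) (suc zero)
    cls-independent x y det≉0 = case (det x y ≟ 0#)
      where
      case : ∀ d → classify x y d ≡ code (log (det x y)) (suc zero)
      case (yes det≈0) = contradiction det≈0 det≉0
      case (no _) = ≡.refl

    -- If g and h have the two pairs as columns, h g⁻¹ carries one pair to the other.
    transport : ∀ x z x' z' → det x z ≈ 1# → det x' z' ≈ 1# → ∃[ g ] ((act g x ≋ x') × (act g z ≋ z'))
    transport x z x' z' det≈1 det'≈1 = h ∙ g ⁻¹ ,
      column e₁ x x' (act-e₁ g) (act-e₁ h) , column e₂ z z' (act-e₂ g) (act-e₂ h)
      where
      g = fromColumns x z det≈1
      h = fromColumns x' z' det'≈1
      column : ∀ e x x' → act g e ≋ x → act h e ≋ x' → act (h ∙ g ⁻¹) x ≋ x'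
      column e x x' ge≋x he≋x' = ≋-trans (act-∙ h (g ⁻¹) x) (≋-trans
        (act-cong h (≋-trans (act-cong (g ⁻¹) (≋-sym ge≋x)) (act-⁻¹ g e))) he≋x')

    -- Complements complete x and x' to bases of determinant 1. The element carrying one basis to
    -- the other sends y = c x to c x', which differs from y' = c' x' by a power of ι.
    orbit-dependent : ∀ x y x' y' → IsPt x → IsPt y → IsPt x' → IsPt y' → det x y ≈ 0# → det x' y' ≈ 0# →
      log (ratio x y) ≡ log (ratio x' y') → ∃[ g ] ((act g x ~ x') × (act g y ~ y'))
    orbit-dependent x y x' y' ptx pty ptx' pty' det≈0 det'≈0 eq =
      let y≋cx : y ≋ scale (ratio x y) x
          y≋cx = parallel {x} {y} ptx det≈0
          y'≋c'x' : y' ≋ scale (ratio x' y') x'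
          y'≋c'x' = parallel {x'} {y'} ptx' det'≈0
          (k , ι^k*c≈c') = log-injective (ratio-≉0 {x} {y} pty y≋cx) (ratio-≉0 {x'} {y'} pty' y'≋c'x') eq
          (g , gx≋x' , _) = transport x (complement x) x' (complement x') (det-complement x ptx) (det-complement x' ptx')
          gy≋cx' : act g y ≋ scale (ratio x y) x'
          gy≋cx' = ≋-trans (act-cong g y≋cx) (≋-trans (act-scale g (ratio x y) x) (scale-cong refl gx≋x'))
      in g , ≋⇒~ {act g x} {x'} gx≋x' , ι-scale⇒~ {act g y} {y'} k (≋-trans (scale-cong refl gy≋cx')
           (≋-trans (scale-scale _ _ x') (≋-trans (scale-cong ι^k*c≈c' ≋-refl) (≋-sym y'≋c'x'))))

    orbit-independent : ∀ x y x' y' → ¬ (det x y ≈ 0#) → ¬ (det x' y' ≈ 0#) →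
      log (det x y) ≡ log (det x' y') → ∃[ g ] ((act g x ~ x') × (act g y ~ y'))
    orbit-independent x y x' y' det≉0 det'≉0 eq =
      let δ = det x y
          (k , ι^k*δ≈δ') = log-injective det≉0 det'≉0 eq
          (e , δ*e≈1) = inverse δ det≉0
          -- Here s = ι^(-k). As det(x', y') = ι^k δ, the factor e s is its inverse; after both
          -- pairs are normalised to determinant 1, the transporting element sends y to s y'.
          s = pow ι (3 ℕ.* k)
          det≈1 : det x (scale e y) ≈ 1#
          det≈1 = trans (det-scaleʳ x e y) (trans (*-comm e δ) δ*e≈1)
          det'≈1 : det x' (scale (e * s) y') ≈ 1#
          det'≈1 = begin
            det x' (scale (e * s) y')     ≈⟨ det-scaleʳ x' (e * s) y' ⟩
            (e * s) * det x' y'           ≈⟨ *-congˡ ι^k*δ≈δ' ⟨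
            (e * s) * (pow ι k * δ)       ≈⟨ solve 4 (λ e s i δ →
              (e :* s) :* (i :* δ) := (s :* i) :* (δ :* e)) refl e s (pow ι k) δ ⟩
            (s * pow ι k) * (δ * e)       ≈⟨ *-cong (ι-pow-3* k) δ*e≈1 ⟩
            1# * 1#                       ≈⟨ *-identityˡ 1# ⟩
            1#                            ∎
          (g , gx≋x' , gz≋z') = transport x (scale e y) x' (scale (e * s) y') det≈1 det'≈1
          y≋δz : y ≋ scale δ (scale e y)
          y≋δz = ≋-sym (≋-trans (scale-scale δ e y) (≋-trans (scale-cong δ*e≈1 ≋-refl) (scale-1 y)))
          δ*e*s≈s : δ * (e * s) ≈ s
          δ*e*s≈s = trans (sym (*-assoc δ e s)) (trans (*-congʳ δ*e≈1) (*-identityˡ s))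
          sy'≋gy : scale s y' ≋ act g y
          sy'≋gy = ≋-sym (≋-trans (act-cong g y≋δz) (≋-trans (act-scale g δ (scale e y)) (≋-trans
            (scale-cong refl gz≋z') (≋-trans (scale-scale δ (e * s) y') (scale-cong δ*e*s≈s ≋-refl)))))
      in g , ≋⇒~ {act g x} {x'} gx≋x' , ~-sym {y'} {act g y} (ι-scale⇒~ {y'} {act g y} (3 ℕ.* k) sy'≋gy)

    -- Passing to representatives ι^k g x and ι^l g y multiplies the determinant by ι^(k+l) and the
    -- ratio by ι^(l-k), written l + 3k; `log` sees neither.
    cls-orbit : ∀ x y x' y' g → IsPt x → IsPt y → IsPt x' →
      act g x ~ x' → act g y ~ y' → cls x y ≡ cls x' y'
    cls-orbit x y x' y' g ptx pty ptx' (k , gx≋) (l , gy≋) = case (det x y ≟ 0#)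
      where
      ι^k ι^l ι^3k c : Carrier
      ι^k = pow ι (toℕ k)
      ι^l = pow ι (toℕ l)
      ι^3k = pow ι (3 ℕ.* toℕ k)
      c = ratio x y
      det-orbit : (ι^k * ι^l) * det x y ≈ det x' y'
      det-orbit = trans (*-congˡ (sym (det-act g x y)))
        (trans (sym (det-scale _ (act g x) _ (act g y))) (det-cong gx≋ gy≋))
      case : Dec (det x y ≈ 0#) → cls x y ≡ cls x' y'
      case (no det≉0) = ≡.trans (cls-independent x y det≉0) (≡.trans
        (≡.cong (λ i → code i (suc zero)) (log-ι (toℕ k ℕ.+ toℕ l) det≉0 (trans (*-congʳ (pow-+ ι (toℕ k) (toℕ l))) det-orbit)))
        (≡.sym (cls-independent x' y' λ det'≈0 →
          *-≉0 (*-≉0 (pow-≉0 (toℕ k) ι≉0) (pow-≉0 (toℕ l) ι≉0)) det≉0 (trans det-orbit det'≈0))))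
      case (yes det≈0) = ≡.trans (cls-dependent x y det≈0) (≡.trans
        (≡.cong (λ i → code i zero) (log-ι (toℕ l ℕ.+ 3 ℕ.* toℕ k) (ratio-≉0 {x} {y} pty y≋cx)
          (trans (*-congʳ (pow-+ ι (toℕ l) (3 ℕ.* toℕ k))) (sym (ratio-scale {p = x'} {y'} ptx' y'≋)))))
        (≡.sym (cls-dependent x' y' (trans (sym det-orbit) (trans (*-congˡ det≈0) (zeroʳ _))))))
        where
        y≋cx : y ≋ scale c x
        y≋cx = parallel {x} {y} ptx det≈0
        gx≋′ : scale ι^3k x' ≋ act g x
        gx≋′ = scale-inverse {p = act g x} {x'} (ι-pow-3* (toℕ k)) gx≋
        y'≋ : y' ≋ scale ((ι^l * ι^3k) * c) x'
        y'≋ = ≋-trans (≋-sym gy≋) (≋-trans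
          (scale-cong refl (≋-trans (act-cong g y≋cx) (≋-trans (act-scale g c x) (scale-cong refl (≋-sym gx≋′)))))
          (≋-trans (scale-cong refl (scale-scale c ι^3k x')) (≋-trans (scale-scale ι^l (c * ι^3k) x')
            (scale-cong (solve 3 (λ a b c → a :* (c :* b) := (a :* b) :* c) refl ι^l ι^3k c) ≋-refl))))

    schurian : IsSchurian m cls
    schurian x y x' y' ptx pty ptx' pty' =
      (λ eq → orbit eq (det x y ≟ 0#) (det x' y' ≟ 0#)) ,
      λ (g , gx~x' , gy~y') → cls-orbit x y x' y' g ptx pty ptx' gx~x' gy~y'
      where
      codes : ∀ {i b i' b'} → cls x y ≡ cls x' y' → cls x y ≡ code i b → cls x' y' ≡ code i' b' → i ≡ i' × b ≡ b'
      codes eq cls≡ cls'≡ = code-injective _ _ _ _ (≡.trans (≡.sym cls≡) (≡.trans eq cls'≡))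
      orbit : cls x y ≡ cls x' y' → Dec (det x y ≈ 0#) → Dec (det x' y' ≈ 0#) →
        ∃[ g ] ((act g x ~ x') × (act g y ~ y'))
      orbit eq (yes det≈0) (yes det'≈0) = orbit-dependent x y x' y' ptx pty ptx' pty' det≈0 det'≈0
        (proj₁ (codes eq (cls-dependent x y det≈0) (cls-dependent x' y' det'≈0)))
      orbit eq (no det≉0) (no det'≉0) = orbit-independent x y x' y' det≉0 det'≉0
        (proj₁ (codes eq (cls-independent x y det≉0) (cls-independent x' y' det'≉0)))
      orbit eq (yes det≈0) (no det'≉0) =
        contradiction (proj₂ (codes eq (cls-dependent x y det≈0) (cls-independent x' y' det'≉0))) λ ()
      orbit eq (no det≉0) (yes det'≈0) =
        contradiction (proj₂ (codes eq (cls-independent x y det≉0) (cls-dependent x' y' det'≈0))) λ ()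

  -- Applied with A = F to count all points and with A = 𝔽₅ to count those of a block.
  lines-size : ∀ {A : Carrier → Set} {n m} → (∀ k {c} → A c → A (pow ι k * c)) → A 0# →
    HasSize _≈_ A n → n ℕ.* n ≡ suc m →
    ∃[ v ] (HasSize _~_ (λ (x , y) → (A x × A y) × IsPt (x , y)) v × v ℕ.* 4 ≡ m)
  lines-size {A} {n} {m} A-ι A0 A-size n²≡1+m = quotient-size ~-isEquivalence ≋-isEquivalence _~?_
    ≋⇒~ A²-size orbit
    where
    A²-size : HasSize _≋_ (λ (x , y) → (A x × A y) × IsPt (x , y)) m
    A²-size = size-remove ≋-isEquivalence (A0 , A0)
      (≡.subst (HasSize _≋_ (λ (x , y) → A x × A y)) n²≡1+m (size-× {_≈_ = _≈_} {_≈_} {A} {A} A-size A-size))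
    orbit : ∀ p → (A (proj₁ p) × A (proj₂ p)) × IsPt p →
      HasSize _≋_ (λ r → ((A (proj₁ r) × A (proj₂ r)) × IsPt r) × p ~ r) 4
    orbit p@(x , y) ((Ax , Ay) , pt) =
      (λ k → scale (pow ι (toℕ k)) p) ,
      (λ k → ((A-ι (toℕ k) Ax , A-ι (toℕ k) Ay) , IsPt-scale (pow-≉0 (toℕ k) ι≉0) pt) , k , ≋-refl) ,
      injective , λ r (_ , k , eq) → k , ≋-sym eq
      where
      injective : ∀ k l → scale (pow ι (toℕ k)) p ≋ scale (pow ι (toℕ l)) p → k ≡ l
      injective k l (e , e') with x ≟ 0# | y ≟ 0#
      ... | no x≉0 | _ = ι-pow-injective k l (cancelˡ _ _ x≉0 (trans (*-comm x _) (trans e (*-comm _ x))))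
      ... | yes _ | no y≉0 = ι-pow-injective k l (cancelˡ _ _ y≉0 (trans (*-comm y _) (trans e' (*-comm _ y))))
      ... | yes x≈0 | yes y≈0 = contradiction (x≈0 , y≈0) pt

  private
    points : ∃[ v ] (HasSize _~_ (λ p → (⊤ × ⊤) × IsPt p) v × v ℕ.* 4 ≡ q ℕ.* q ℕ.∸ 1)
    points = lines-size (λ _ _ → tt) tt finite
      -- Holds by computation once q is written as a successor.
      (≡.subst (λ n → n ℕ.* n ≡ suc (n ℕ.* n ℕ.∸ 1)) (≡.sym q≡1+4N) ≡.refl)

    v≡ : (q ℕ.* q ℕ.∸ 1) ℕ./ 4 ≡ proj₁ points
    v≡ = ≡.trans (ℕ./-congˡ {o = 4} (≡.sym (proj₂ (proj₂ points)))) (ℕ.m*n/n≡m (proj₁ points) 4)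

  points-count : (q ℕ.* q ℕ.∸ 1) ℕ./ 4 ℕ.* 4 ≡ q ℕ.* q ℕ.∸ 1
  points-count = ≡.trans (≡.cong (ℕ._* 4) v≡) (proj₂ (proj₂ points))

  points-size : HasSize _~_ IsPt ((q ℕ.* q ℕ.∸ 1) ℕ./ 4)
  points-size = ≡.subst (HasSize _~_ IsPt) (≡.sym v≡)
    (size-⇔ ~-isEquivalence (λ _ → proj₂ , ((tt , tt) ,_)) (proj₁ (proj₂ points)))

  -- The 25 - 1 nonzero vectors of 𝔽₅² fall into classes of size 4.
  K-lines-size : HasSize _~_ (λ u → K² u × IsPt u) 6
  K-lines-size = ≡.subst (HasSize _~_ (λ u → K² u × IsPt u)) (ℕ.*-cancelʳ-≡ (proj₁ lines) 6 4 (proj₂ (proj₂ lines))) (proj₁ (proj₂ lines))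
    where
    lines : ∃[ v ] (HasSize _~_ (λ u → K² u × IsPt u) v × v ℕ.* 4 ≡ 24)
    lines = lines-size {A = K} {n = 5} {m = 24} (λ k → K-* (K-ι-pow k)) K-0 K-size ≡.refl

  block-size : ∀ g → HasSize _~_ (λ p → IsPt p × InB g p) 6
  block-size g = size-image ~-isEquivalence {_≈′_ = _~_} {P = λ u → K² u × IsPt u} {Q = λ p → IsPt p × InB g p} (λ u _ → act g u)
    in-block (λ u v _ _ → act-~ g {u} {v}) (λ u v _ _ → act-~⁻¹ g u v)
    (λ p (_ , p∈g) → let (u , pt , Ku , p≋gu) = InB⇒K² g p p∈g in u , (Ku , pt) , ≋⇒~ {p} {act g u} p≋gu)
    K-lines-size
    where
    in-block : ∀ u → K² u × IsPt u → IsPt (act g u) × InB g (act g u)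
    in-block u (Ku , pt) = IsPt-act g pt , K²⇒InB g (act g u) u pt Ku ≋-refl

  -- Cosets of 𝔽₅ in F and the blocks through a point.

  K? : ∀ c → Dec (K c)
  K? c = Dec.map′ (λ (j , c≈j) → toℕ j , c≈j) (proj₂ (proj₂ (proj₂ K-size)) c)
    (Fin.any? {n = 5} λ j → c ≟ ⟦ toℕ j ⟧)

  _≈ₖ_ : Carrier → Carrier → Set
  f ≈ₖ f' = K (f + - f')

  ≈ₖ-isEquivalence : IsEquivalence _≈ₖ_
  ≈ₖ-isEquivalence = record
    { refl = λ {f} → K-resp (sym (-‿inverseʳ f)) K-0
    ; sym = λ {f} {f'} Kd → K-resp (solve 2 (λ f f' → :- (f :+ :- f') := f' :+ :- f) refl f f') (K-neg Kd)
    ; trans = λ {f} {f'} {f″} Kd Kd' → K-resp (solve 3 (λ f f' f″ → (f :+ :- f') :+ (f' :+ :- f″) := f :+ :- f″) refl f f' f″) (K-+ Kd Kd') }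

  cosets-size : ∃[ r ] (HasSize _≈ₖ_ (λ _ → ⊤) r × r ℕ.* 5 ≡ q)
  cosets-size = quotient-size ≈ₖ-isEquivalence isEquivalence (λ f f' → K? (f + - f'))
    (λ {f} {f'} f≈f' → K-resp (sym (trans (+-congʳ f≈f') (-‿inverseʳ f'))) K-0) finite
    λ f _ → size-image isEquivalence {P = K} (λ c _ → f + c)
      (λ c Kc → tt , K-resp (solve 2 (λ f c → :- c := f :+ :- (f :+ c)) refl f c) (K-neg Kc))
      (λ c c' _ _ → +-congˡ) (λ c c' _ _ → +-cancelˡ f c c')
      (λ f' (_ , Kd) → f' + - f , K-resp (solve 2 (λ f f' → :- (f :+ :- f') := f' :+ :- f) refl f f') (K-neg Kd) ,
        solve 2 (λ f f' → f' := f :+ (f' :+ :- f)) refl f f')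
      K-size

  r = proj₁ cosets-size

  -- A block through x is spanned by x and y + f x, for y fixed with det x y = 1 and f unique modulo 𝔽₅.
  blocks-through-point : ∀ x → IsPt x → HasSize _≈B_ (λ B → InB B x) r
  blocks-through-point x@(x₁ , x₂) pt = size-image ≈B-isEquivalence {P = λ _ → ⊤} (λ f _ → block f)
    (λ f _ → x∈ f)
    -- If f - f' lies in 𝔽₅, then y + f x = (y + f' x) + (f - f') x lies in the lattice spanned by x
    -- and y + f' x.
    (λ f f' _ _ Kd → block-unique (block f) (block f') x (shear f) (1≈⇒≉0 (det≈1 f)) (x∈ f) (shear∈ f) (x∈ f')
      (K²⇒InB (block f') (shear f) (f + - f' , 1#) (λ (_ , z) → 1≉0 z) (Kd , K-1) (shear-difference f f')))
    -- Conversely, equal blocks contain both y + f x and y + f' x, whose determinant is f - f'.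
    (λ f f' _ _ eq → K-resp (det-shear f f')
      (common-block⇒K-det (block f') (shear f) (shear f')
        (proj₁ (eq (shear f) (InB⇒IsPt (block f) (shear f) (shear∈ f))) (shear∈ f)) (shear∈ f')))
    -- Writing x = g u, the image z of the complement of u lies in the block and satisfies det(x, z)
    -- = 1. Hence z = y + f x, with f = det(z, y) the Cramer coefficient of x.
    (λ g x∈g → let (u , ptu , Ku , x≋gu) = InB⇒K² g x x∈g
                   z = act g (complement u)
                   detxz≈1 : det x z ≈ 1#
                   detxz≈1 = trans (det-cong x≋gu ≋-refl) (trans (det-act g u (complement u)) (det-complement u ptu))
                   f = det z y
                   z≋shear : z ≋ shear f
                   z≋shear = ≋-trans (cramer {1#} x y z (trans (*-identityˡ _) (det-complement x pt)))
                     (combination-cong (*-identityˡ f) ≋-refl (trans (*-identityˡ _) detxz≈1) ≋-refl)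
                   z∈g : InB g z
                   z∈g = K²⇒InB g z (complement u) (complement-IsPt u ptu) (K²-complement {u} Ku) ≋-refl
               in f , tt , block-unique g (block f) x z (1≈⇒≉0 detxz≈1) x∈g z∈g (x∈ f)
                    (InB-~ (block f) (shear f) z (≋⇒~ (≋-sym z≋shear)) (shear∈ f)))
    (proj₁ (proj₂ cosets-size))
    where
    y = complement x
    y₁ = proj₁ y
    y₂ = proj₂ y
    shear : Carrier → Vec2
    shear f = combination f x 1# y
    det-xy : x₁ * y₂ + - (y₁ * x₂) ≈ 1#
    det-xy = det-complement x pt
    det≈1 : ∀ f → det x (shear f) ≈ 1#
    det≈1 f = trans (solve 5 (λ x₁ x₂ y₁ y₂ f → x₁ :* (x₂ :* f :+ y₂ :* con 1) :+ :- ((x₁ :* f :+ y₁ :* con 1) :* x₂)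
      := x₁ :* y₂ :+ :- (y₁ :* x₂)) refl x₁ x₂ y₁ y₂ f) det-xy
    block : Carrier → SL
    block f = fromColumns x (shear f) (det≈1 f)
    x∈ : ∀ f → InB (block f) x
    x∈ f = column₁∈ x (shear f) (det≈1 f)
    shear∈ : ∀ f → InB (block f) (shear f)
    shear∈ f = column₂∈ x (shear f) (det≈1 f)
    shear-difference : ∀ f f' → shear f ≋ act (block f') (f + - f' , 1#)
    shear-difference f f' = component x₁ y₁ , component x₂ y₂
      where
      component : ∀ x y → x * f + y * 1# ≈ x * (f + - f') + (x * f' + y * 1#) * 1#
      component x y = solve 4 (λ x y f f' → x :* f :+ y :* con 1 := x :* (f :+ :- f') :+ (x :* f' :+ y :* con 1) :* con 1) refl x y f f'
    det-shear : ∀ f f' → det (shear f) (shear f') ≈ f + - f'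
    det-shear f f' = trans (solve 6 (λ x₁ x₂ y₁ y₂ f f' →
        (x₁ :* f :+ y₁ :* con 1) :* (x₂ :* f' :+ y₂ :* con 1) :+ :- ((x₁ :* f' :+ y₁ :* con 1) :* (x₂ :* f :+ y₂ :* con 1))
        := (f :+ :- f') :* (x₁ :* y₂ :+ :- (y₁ :* x₂))) refl x₁ x₂ y₁ y₂ f f')
      (trans (*-congˡ det-xy) (*-identityʳ _))
    complement-IsPt : ∀ u → IsPt u → IsPt (complement u)
    complement-IsPt u ptu (z , z') = 1≉0 (trans (sym (det-complement u ptu))
      (trans (det-cong {u} ≋-refl (z , z')) (solve 2 (λ a b → a :* con 0 :+ :- (con 0 :* b) := con 0) refl (proj₁ u) (proj₂ u))))

  -- Double counting of flags.

  q/5≡r : q ℕ./ 5 ≡ r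
  q/5≡r = ≡.trans (ℕ./-congˡ {o = 5} (≡.sym (proj₂ (proj₂ cosets-size)))) (ℕ.m*n/n≡m r 5)

  -- Puts every point on some flag, so that flags sorted by point have exactly one class per point.
  spanned-by : ∀ p → IsPt p → SL
  spanned-by p pt = fromColumns p (complement p) (det-complement p pt)

  Flag : SL × Vec2 → Set
  Flag (g , p) = IsPt p × InB g p

  _≈Flag_ : SL × Vec2 → SL × Vec2 → Set
  (g , p) ≈Flag (h , p') = (g ≈B h) × (p ~ p')

  ≈Flag-isEquivalence : IsEquivalence _≈Flag_
  ≈Flag-isEquivalence = record
    { refl = λ { {g , p} → IsEquivalence.refl ≈B-isEquivalence {g} , ~-refl {p} }
    ; sym = λ { {g , p} {h , p'} (e , e') → IsEquivalence.sym ≈B-isEquivalence {g} {h} e , ~-sym {p} {p'} e' }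
    ; trans = λ { {g , p} {h , p'} {k , p″} (e , e') (f , f') →
        IsEquivalence.trans ≈B-isEquivalence {g} {h} {k} e f , ~-trans {p} {p'} {p″} e' f' } }

  -- The two coarsenings of flag equality behind the double count: the classes of the first have
  -- size r, those of the second size 6.
  SamePoint SameBlock : SL × Vec2 → SL × Vec2 → Set
  SamePoint (_ , p) (_ , p') = p ~ p'
  SameBlock (g , _) (h , _) = g ≈B h

  SamePoint-isEquivalence : IsEquivalence SamePoint
  SamePoint-isEquivalence = record
    { refl = λ { {_ , p} → ~-refl {p} } ; sym = λ { {_ , p} {_ , p'} → ~-sym {p} {p'} }
    ; trans = λ { {_ , p} {_ , p'} {_ , p″} → ~-trans {p} {p'} {p″} } }

  SameBlock-isEquivalence : IsEquivalence SameBlock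
  SameBlock-isEquivalence = record
    { refl = λ { {g , _} → IsEquivalence.refl ≈B-isEquivalence {g} }
    ; sym = λ { {g , _} {h , _} → IsEquivalence.sym ≈B-isEquivalence {g} {h} }
    ; trans = λ { {g , _} {h , _} {k , _} → IsEquivalence.trans ≈B-isEquivalence {g} {h} {k} } }

  flags-size : HasSize _≈Flag_ Flag ((q ℕ.* q ℕ.∸ 1) ℕ./ 4 ℕ.* r)
  flags-size = fibre-size SamePoint-isEquivalence {_≈′_ = _≈Flag_} {P = Flag} proj₂ by-point λ (g , p) (pt , _) →
    size-image ≈Flag-isEquivalence {_≈′_ = _≈B_} {P = λ h → InB h p} {Q = λ f → Flag f × SamePoint (g , p) f}
      (λ h _ → h , p)
      (λ h p∈h → (pt , p∈h) , ~-refl {p}) (λ h h' _ _ eq → eq , ~-refl {p}) (λ h h' _ _ → proj₁)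
      (λ (h , p') ((_ , p'∈h) , p~p') → h , InB-~ h p' p (~-sym {p} {p'} p~p') p'∈h ,
        IsEquivalence.refl ≈B-isEquivalence {h} , ~-sym {p} {p'} p~p')
      (blocks-through-point p pt)
    where
    by-point : HasSize SamePoint Flag ((q ℕ.* q ℕ.∸ 1) ℕ./ 4)
    by-point = size-image SamePoint-isEquivalence {_≈′_ = _~_} {P = IsPt} {Q = Flag} (λ p pt → spanned-by p pt , p)
      (λ p pt → pt , column₁∈ p (complement p) (det-complement p pt)) (λ _ _ _ _ → id) (λ _ _ _ _ → id)
      (λ (g , p) (pt , _) → p , pt , ~-refl {p}) points-size

  -- Flags counted by blocks and by points: 6 b = r v.
  blocks-size : HasSize _≈B_ (λ _ → ⊤) ((q ℕ.* (q ℕ.* q ℕ.∸ 1)) ℕ./ 120)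
  blocks-size = ≡.subst (HasSize _≈B_ (λ _ → ⊤)) b≡ (size-image ≈B-isEquivalence {_≈′_ = SameBlock} {P = Flag} {Q = λ _ → ⊤}
    (λ (g , _) _ → g) (λ _ _ → tt) (λ _ _ _ _ → id) (λ _ _ _ _ → id)
    (λ g _ → (g , act g e₁) , (IsPt-act g (T-IsPt zero) , act-T∈ g zero) , IsEquivalence.refl ≈B-isEquivalence {g})
    (proj₁ (proj₂ by-block)))
    where
    v = (q ℕ.* q ℕ.∸ 1) ℕ./ 4
    by-block : ∃[ b ] (HasSize SameBlock Flag b × b ℕ.* 6 ≡ v ℕ.* r)
    by-block = quotient-size {_≈_ = SameBlock} {_≈Flag_} {Flag} SameBlock-isEquivalence ≈Flag-isEquivalence (λ (g , _) (h , _) → g ≈B? h) proj₁ flags-size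
      λ (g , p) _ → size-image ≈Flag-isEquivalence {_≈′_ = _~_} {P = λ p' → IsPt p' × InB g p'} {Q = λ f → Flag f × SameBlock (g , p) f}
        (λ p' _ → g , p')
        (λ p' fl → fl , IsEquivalence.refl ≈B-isEquivalence {g})
        (λ p' p″ _ _ eq → IsEquivalence.refl ≈B-isEquivalence {g} , eq) (λ p' p″ _ _ → proj₂)
        (λ (h , p') ((pt' , p'∈h) , g≈h) → p' , (pt' , proj₂ (g≈h p' pt') p'∈h) ,
          IsEquivalence.sym ≈B-isEquivalence {g} {h} g≈h , ~-refl {p'})
        (block-size g)
    b = proj₁ by-block
    b≡ : b ≡ (q ℕ.* (q ℕ.* q ℕ.∸ 1)) ℕ./ 120
    -- Multiplying 6 b = v r by 20 gives 120 b = (5 r)(4 v) = q (q² - 1).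
    b≡ = ≡.trans (≡.sym (ℕ.m*n/n≡m b 120)) (ℕ./-congˡ {o = 120}
      (≡.trans (≡.sym (ℕ.*-assoc b 6 20))
      (≡.trans (≡.cong (ℕ._* 20) (proj₂ (proj₂ by-block)))
      (≡.trans (rearrange v r)
      (≡.cong₂ ℕ._*_ (proj₂ (proj₂ cosets-size)) points-count)))))
      where
      rearrange : ∀ v r → v ℕ.* r ℕ.* 20 ≡ r ℕ.* 5 ℕ.* (v ℕ.* 4)
      rearrange = N.solve 2 (λ v r → v N.:* r N.:* N.con 20 N.:= r N.:* N.con 5 N.:* (v N.:* N.con 4)) ≡.refl
        where module N = +-*-Solver

  -- The axioms of the scheme and of the design.

  module Design (m : ℕ) (N*2≡1+m : N ℕ.* 2 ≡ suc m) where
    open Classification m N*2≡1+m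

    identity : SL
    identity = fromColumns e₁ e₂ (solve 0 (con 1 :* con 1 :+ :- (con 0 :* con 0) := con 1) refl)

    act-identity : ∀ p → act identity p ≋ p
    act-identity (x , y) = solve 2 (λ x y → con 1 :* x :+ con 0 :* y := x) refl x y ,
                           solve 2 (λ x y → con 0 :* x :+ con 1 :* y := y) refl x y

    cls-respects : ∀ x x' y y' → IsPt x → IsPt y → x ~ x' → y ~ y' → cls x y ≡ cls x' y'
    cls-respects x x' y y' ptx pty x~x' y~y' = cls-orbit x y x' y' identity ptx pty (IsPt-~ {x} {x'} x~x' ptx)
      (~-trans {act identity x} {x} {x'} (≋⇒~ (act-identity x)) x~x')
      (~-trans {act identity y} {y} {y'} (≋⇒~ (act-identity y)) y~y')

    log-0⇒ι-pow : ∀ {c} → ¬ (c ≈ 0#) → toℕ (log c) ≡ 0 → ∃[ k ] (c ≈ pow ι k)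
    log-0⇒ι-pow {c} c≉0 eq = let (k , ι^k≈c) = log-injective 1≉0 c≉0 (Fin.toℕ-injective (≡.trans log-1 (≡.sym eq)))
      in k , sym (trans (sym (*-identityʳ _)) ι^k≈c)

    cls-diagonal : ∀ x y → IsPt x → IsPt y → (toℕ (cls x y) ≡ 0) ⇔ (x ~ y)
    cls-diagonal x y ptx pty = (λ eq → to eq (det x y ≟ 0#)) , from
      where
      to : toℕ (cls x y) ≡ 0 → Dec (det x y ≈ 0#) → x ~ y
      to eq (no det≉0) = contradiction (≡.trans (≡.sym (≡.trans (≡.cong toℕ (cls-independent x y det≉0))
        (toℕ-code (log (det x y)) (suc zero)))) eq) (ℕ.m+1+n≢0 (2 ℕ.* toℕ (log (det x y))))
      to eq (yes det≈0) =
        let y≋cx : y ≋ scale (ratio x y) x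
            y≋cx = parallel {x} {y} ptx det≈0
            2*log≡0 = ≡.trans (≡.sym (≡.trans (≡.cong toℕ (cls-dependent x y det≈0)) (toℕ-code (log (ratio x y)) zero))) eq
            (k , c≈ι^k) = log-0⇒ι-pow (ratio-≉0 {x} {y} pty y≋cx)
              (ℕ.m+n≡0⇒m≡0 (toℕ (log (ratio x y))) (ℕ.m+n≡0⇒m≡0 (2 ℕ.* toℕ (log (ratio x y))) 2*log≡0))
        in ι-scale⇒~ {x} {y} k (≋-trans (scale-cong (sym c≈ι^k) ≋-refl) (≋-sym y≋cx))
      from : x ~ y → toℕ (cls x y) ≡ 0
      -- Replacing y by x leaves the pair (x, x), whose ratio is 1.
      from x~y = ≡.trans (≡.cong toℕ (≡.trans (cls-respects x x y x ptx pty (~-refl {x}) (~-sym {x} {y} x~y))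
        (cls-dependent x x det-xx))) (≡.trans (toℕ-code (log (ratio x x)) zero) (≡.cong (λ n → 2 ℕ.* n ℕ.+ 0)
          (≡.trans (≡.cong toℕ (≡.sym (log-ι 0 1≉0 (trans (*-identityˡ 1#) (sym (ratio-scale {p = x} {x} ptx (≋-sym (scale-1 x)))))))) log-1)))
        where
        det-xx : det x x ≈ 0#
        det-xx = solve 2 (λ a b → a :* b :+ :- (a :* b) := con 0) refl (proj₁ x) (proj₂ x)

    -- Since ω^i has logarithm i, the pair e₁, ω^i e₁ realises i as a ratio and the pair e₁, ω^i e₂
    -- realises it as a determinant.
    cls-nonempty : ∀ j → ∃[ x ] ∃[ y ] (IsPt x × IsPt y × cls x y ≡ j)
    cls-nonempty j with code-surjective j
    ... | i , zero , code≡j = e₁ , scale c e₁ , T-IsPt zero , IsPt-scale (pow-≉0 (toℕ i) ω≉0) (T-IsPt zero) ,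
      ≡.trans (cls-dependent e₁ (scale c e₁) (solve 1 (λ c → con 1 :* (c :* con 0) :+ :- ((c :* con 1) :* con 0) := con 0) refl c))
        (≡.trans (≡.cong (λ i → code i zero) (≡.trans (log-ι 0 ratio≉0 (trans (*-identityˡ _) ratio≈c)) (log-surjective i))) code≡j)
      where
      c = pow ω (toℕ i)
      ratio≈c : ratio e₁ (scale c e₁) ≈ c
      ratio≈c = ratio-scale {c} {e₁} {scale c e₁} (T-IsPt zero) ≋-refl
      ratio≉0 : ¬ (ratio e₁ (scale c e₁) ≈ 0#)
      ratio≉0 eq = pow-≉0 (toℕ i) ω≉0 (trans (sym ratio≈c) eq)
    ... | i , suc zero , code≡j = e₁ , scale c e₂ , T-IsPt zero , IsPt-scale (pow-≉0 (toℕ i) ω≉0) (T-IsPt (suc zero)) ,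
      ≡.trans (cls-independent e₁ (scale c e₂) det≉0)
        (≡.trans (≡.cong (λ i → code i (suc zero)) (≡.trans (log-ι 0 det≉0 (trans (*-identityˡ _) det≈c)) (log-surjective i))) code≡j)
      where
      c = pow ω (toℕ i)
      det≈c : det e₁ (scale c e₂) ≈ c
      det≈c = solve 1 (λ c → con 1 :* (c :* con 1) :+ :- ((c :* con 0) :* con 0) := c) refl c
      det≉0 : ¬ (det e₁ (scale c e₂) ≈ 0#)
      det≉0 eq = pow-≉0 (toℕ i) ω≉0 (trans (sym det≈c) eq)

    -- An element carrying (x, y) to (x', y') also carries (y, x) to (y', x'), so the index of the
    -- transposed relation can be taken from any single pair.
    cls-transpose : ∀ x y x' y' → IsPt x → IsPt y → IsPt x' → IsPt y' → cls x y ≡ cls x' y' → cls y x ≡ cls y' x'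
    cls-transpose x y x' y' ptx pty ptx' pty' eq = let (g , gx~x' , gy~y') = proj₁ (schurian x y x' y' ptx pty ptx' pty') eq
      in cls-orbit y x y' x' g pty ptx pty' gy~y' gx~x'

    -- The count is made at one representative pair of relation k; an element g carrying it to
    -- another pair of that relation matches the two sets of middle points by y ↦ g y.
    cls-intersection : ∀ i j k → ∃[ p ] (∀ x z → IsPt x → IsPt z → cls x z ≡ k →
      HasSize _~_ (λ y → IsPt y × cls x y ≡ i × cls y z ≡ j) p)
    cls-intersection i j k with x , z , ptx , ptz , cls≡k ← cls-nonempty k = proj₁ S , λ x' z' ptx' ptz' cls'≡k →
      let (g , gx~x' , gz~z') = proj₁ (schurian x z x' z' ptx ptz ptx' ptz') (≡.trans cls≡k (≡.sym cls'≡k))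
          left : ∀ y → IsPt y → cls x y ≡ cls x' (act g y)
          left y pty = cls-orbit x y x' (act g y) g ptx pty ptx' gx~x' (~-refl {act g y})
          right : ∀ y → IsPt y → cls y z ≡ cls (act g y) z'
          right y pty = cls-orbit y z (act g y) z' g pty ptz (IsPt-act g pty) (~-refl {act g y}) gz~z'
          back : ∀ y → y ~ act g (act (g ⁻¹) y)
          back y = ≋⇒~ {y} {act g (act (g ⁻¹) y)} (≋-sym (act-⁻¹ʳ g y))
      in size-image ~-isEquivalence {_≈′_ = _~_} {P = λ y → IsPt y × cls x y ≡ i × cls y z ≡ j}
           {Q = λ y → IsPt y × cls x' y ≡ i × cls y z' ≡ j} (λ y _ → act g y)
           (λ y (pty , eq , eq') → IsPt-act g pty , ≡.trans (≡.sym (left y pty)) eq , ≡.trans (≡.sym (right y pty)) eq')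
           (λ y y' _ _ → act-~ g {y} {y'})
           (λ y y' _ _ → act-~⁻¹ g y y')
           (λ y (pty , eq , eq') →
             let y₀ = act (g ⁻¹) y
                 pt₀ = IsPt-act (g ⁻¹) pty
             in y₀ , (pt₀ ,
               ≡.trans (left y₀ pt₀) (≡.trans (≡.sym (cls-respects x' x' y (act g y₀) ptx' pty (~-refl {x'}) (back y))) eq) ,
               ≡.trans (right y₀ pt₀) (≡.trans (≡.sym (cls-respects y (act g y₀) z' z' pty ptz' (back y) (~-refl {z'}))) eq')) , back y)
           (proj₂ S)
      where
      S : ∃[ p ] HasSize _~_ (λ y → IsPt y × cls x y ≡ i × cls y z ≡ j) p
      S = subset-size ~-isEquivalence _~?_ {_≈′_ = _~_} {P = IsPt} {Q = λ y → cls x y ≡ i × cls y z ≡ j}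
        (λ y → (cls x y Fin.≟ i) ×-dec (cls y z Fin.≟ j)) id
        (λ {y} {y'} pty pty' y~y' (eq , eq') →
          ≡.trans (≡.sym (cls-respects x x y y' ptx pty (~-refl {x}) y~y')) eq ,
          ≡.trans (≡.sym (cls-respects y y' z z pty ptz y~y' (~-refl {z}))) eq')
        points-size

    scheme : IsAssociationScheme _~_ IsPt m cls
    scheme = record
      { respects = cls-respects
      ; diagonal = cls-diagonal
      ; nonempty = cls-nonempty
      ; transpose = λ j → let (x₀ , y₀ , ptx₀ , pty₀ , cls₀≡j) = cls-nonempty j in cls y₀ x₀ , λ x y ptx pty →
          (λ eq → cls-transpose x y x₀ y₀ ptx pty ptx₀ pty₀ (≡.trans eq (≡.sym cls₀≡j))) ,
          (λ eq → ≡.trans (cls-transpose y x y₀ x₀ pty ptx pty₀ ptx₀ eq) cls₀≡j)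
      ; intersection = cls-intersection }

    -- An odd index comes from a nonzero determinant, and 1 = 2 · 0 + 1 forces logarithm 0, that is,
    -- a determinant in ⟨ι⟩.
    cls-1⇒K-det : ∀ x y → toℕ (cls x y) ≡ 1 → K (det x y) × ¬ (det x y ≈ 0#)
    cls-1⇒K-det x y cls≡1 = case (det x y ≟ 0#)
      where
      case : Dec (det x y ≈ 0#) → K (det x y) × ¬ (det x y ≈ 0#)
      case (yes det≈0) = contradiction (≡.trans (≡.sym (ℕ.+-identityʳ _)) (≡.trans
        (≡.sym (≡.trans (≡.cong toℕ (cls-dependent x y det≈0)) (toℕ-code (log (ratio x y)) zero))) cls≡1))
        (ℕ.even≢odd (toℕ (log (ratio x y))) 0)
      case (no det≉0) =
        let 2*log+1≡1 = ≡.trans (≡.sym (≡.trans (≡.cong toℕ (cls-independent x y det≉0)) (toℕ-code (log (det x y)) (suc zero)))) cls≡1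
            (k , det≈ι^k) = log-0⇒ι-pow det≉0 (ℕ.m+n≡0⇒m≡0 (toℕ (log (det x y))) (ℕ.+-cancelʳ-≡ 1 (2 ℕ.* toℕ (log (det x y))) 0 2*log+1≡1))
        in K-resp (sym det≈ι^k) (K-ι-pow k) , det≉0

    -- Distinct points of a block are independent and have determinant in 𝔽₅ˣ = ⟨ι⟩, hence of
    -- logarithm 0.
    common-block⇒cls-1 : ∀ g x y → IsPt x → IsPt y → 1 ℕ.≤ toℕ (cls x y) → InB g x → InB g y → toℕ (cls x y) ≡ 1
    common-block⇒cls-1 g x y ptx pty 1≤cls x∈g y∈g =
      ≡.trans (≡.cong toℕ (cls-independent x y det≉0)) (≡.trans (toℕ-code (log (det x y)) (suc zero))
        (≡.cong (λ n → 2 ℕ.* n ℕ.+ 1) log-det≡0))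
      where
      det≉0 : ¬ (det x y ≈ 0#)
      det≉0 det≈0 = contradiction (proj₂ (cls-diagonal x y ptx pty) (common-block⇒~ g x y x∈g y∈g det≈0)) (ℕ.m<n⇒n≢0 1≤cls)
      log-det≡0 : toℕ (log (det x y)) ≡ 0
      log-det≡0 = let (k , det≈ι^k) = K-unit (common-block⇒K-det g x y x∈g y∈g) det≉0 in
        ≡.trans (≡.cong toℕ (≡.sym (log-ι k 1≉0 (trans (*-identityʳ _) (sym det≈ι^k))))) log-1

    if1-≢1 : ∀ {n} → ¬ (n ≡ 1) → if1 n ≡ 0
    if1-≢1 {0} _ = ≡.refl
    if1-≢1 {1} n≢1 = contradiction ≡.refl n≢1
    if1-≢1 {suc (suc n)} _ = ≡.refl

    balance : ∀ x y → IsPt x → IsPt y → 1 ℕ.≤ toℕ (cls x y) →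
      HasSize _≈B_ (λ B → InB B x × InB B y) (if1 (toℕ (cls x y)))
    balance x y ptx pty 1≤cls = case (toℕ (cls x y) ℕ.≟ 1)
      where
      sized = HasSize _≈B_ (λ B → InB B x × InB B y)
      case : Dec (toℕ (cls x y) ≡ 1) → sized (if1 (toℕ (cls x y)))
      case (yes cls≡1) = let (Kdet , det≉0) = cls-1⇒K-det x y cls≡1 in
        ≡.subst sized (≡.cong if1 (≡.sym cls≡1)) (common-blocks x y Kdet det≉0)
      case (no cls≢1) = ≡.subst sized (≡.sym (if1-≢1 cls≢1)) ((λ ()) , (λ ()) , (λ ()) ,
        λ g (x∈g , y∈g) → contradiction (common-block⇒cls-1 g x y ptx pty 1≤cls x∈g y∈g) cls≢1)

    isGPBIBD : IsGPBIBD _~_ IsPt _≈B_ InB m cls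
      ((q ℕ.* q ℕ.∸ 1) ℕ./ 4) ((q ℕ.* (q ℕ.* q ℕ.∸ 1)) ℕ./ 120) 6 (q ℕ./ 5) (λ j → if1 j)
    isGPBIBD = record
      { scheme = scheme
      ; nPoints = points-size
      ; nBlocks = blocks-size
      ; blockSize = block-size
      ; replication = λ x pt → ≡.subst (HasSize _≈B_ (λ B → InB B x)) (≡.sym q/5≡r) (blocks-through-point x pt)
      ; balance = balance }

-- The number (5^α - 1)/4 = 1 + 5 + ... + 5^(α-1), given by recursion so that it is visibly a
-- successor for α ≥ 1.
quarter : ℕ → ℕ
quarter zero = 0
quarter (suc α) = suc (5 ℕ.* quarter α)

5^α≡1+4*quarter : ∀ α → 5 ℕ.^ α ≡ suc (4 ℕ.* quarter α)
5^α≡1+4*quarter zero = ≡.refl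
5^α≡1+4*quarter (suc α) = ≡.trans (≡.cong (5 ℕ.*_) (5^α≡1+4*quarter α))
  (solve 1 (λ k → con 5 :* (con 1 :+ con 4 :* k) := con 1 :+ con 4 :* (con 1 :+ con 5 :* k)) ≡.refl (quarter α))
  where open +-*-Solver

-- With N = t + 1, q - 3 = 2 (2t + 1), so m + 1 = 2t + 2 = 2N.
class-count : ∀ q t → q ≡ suc (4 ℕ.* suc t) → suc t ℕ.* 2 ≡ suc ((q ℕ.∸ 3) ℕ./ 2)
class-count q t q≡ = ≡.sym (≡.cong suc (≡.trans (ℕ./-congˡ {o = 2} (≡.trans (≡.cong (ℕ._∸ 3) q≡3+) (ℕ.m+n∸m≡n 3 _)))
  (ℕ.m*n/n≡m (suc (t ℕ.* 2)) 2)))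
  where
  open +-*-Solver
  q≡3+ : q ≡ 3 ℕ.+ suc (t ℕ.* 2) ℕ.* 2
  q≡3+ = ≡.trans q≡ (solve 1 (λ t → con 1 :+ con 4 :* (con 1 :+ t) := con 3 :+ (con 1 :+ t :* con 2) :* con 2) ≡.refl t)

open import Data.Nat using (_+_; _*_; _∸_; _^_; _/_; _≤_)

theorem2p11 : (α : ℕ) → 1 ≤ α →
  (F : Field) → IsFiniteOfOrder F (5 ^ α) →
  (ω : Field.Carrier F) →
  (∀ x → ¬ Field._≈_ F x (Field.0# F) → ∃[ n ] Field._≈_ F (Construction.pow F (5 ^ α) ω ω n) x) →
  let q = 5 ^ α
      open Construction F q ω
      m = (q ∸ 3) / 2
  in Σ (Vec2 → Vec2 → Fin (suc m)) λ cls →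
       IsSchurian m cls ×
       IsGPBIBD _~_ IsPt _≈B_ InB m cls
         ((q * q ∸ 1) / 4) ((q * (q * q ∸ 1)) / 120) 6 (q / 5)
         (λ j → if1 j)
theorem2p11 zero ()
theorem2p11 α@(suc α-1) _ F finite ω generates = cls , schurian , isGPBIBD
  where
  5≈0 = FieldProperties.prime-power-characteristic F 5 α (FieldProperties.order·1≈0 F finite)
  q≡1+4N = 5^α≡1+4*quarter α
  open Geometry F 5≈0 (5 ^ α) (quarter α) q≡1+4N finite ω generates
  -- For α ≥ 1, N = `quarter α` unfolds to the successor of `5 * quarter α-1`, which is the required
  -- t.
  N*2≡1+m = class-count (5 ^ α) (5 * quarter α-1) q≡1+4N
  open Classification ((5 ^ α ∸ 3) / 2) N*2≡1+m
  open Design ((5 ^ α ∸ 3) / 2) N*2≡1+m
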